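{- There exists an absolute constant $c>0$ and an infinite family of $k$-unicast instances whose makespan coding gap is at least $\Omega(\log^{c} k)$.
   Context: A $k$-unicast instance $\mathcal{M}=(G,\mathcal{S})$ consists of a connected undirected graph $G=(V,E)$ with an integer capacity $c_e\ge 1$ on each edge and $k$ sessions $\mathcal{S}=\{(s_i,t_i,d_i)\}_{i=1}^k$, where $s_i\in V$ is a source, $t_i\in V$ its sink, and $d_i\in\mathbb{Z}_{\ge1}$ is the number of (equal-size) sub-packets of the packet $s_i$ must deliver to $t_i$. A protocol runs in synchronous rounds; initially $s_i$ knows its packet. In each round every node $v$ sends along each incident edge $e$ a message of at most $c_e$ sub-packets, computed by a predetermined function of the packets $v$ received in earlier rounds and those originating at $v$. Network coding protocols may use arbitrary such functions; routing protocols may only forward sub-packets that $v$ has received so far or that originate at $v$. A protocol has completion times $(T_1,\dots,T_k)$ if for each $i$, after $T_i$ rounds $t_i$ can determine the packet of $s_i$; its makespan is $\max_i T_i$. The makespan coding gap of $\mathcal{M}$ is the ratio of the smallest makespan of any routing protocol for $\mathcal{M}$ to the smallest makespan of any network coding protocol for $\mathcal{M}$. -}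

module Defs where

open import Data.Nat using (ℕ; zero; suc; _≤_; _+_; _*_; _^_)
open import Data.Nat.Logarithm using (⌊log₂_⌋)
open import Data.Fin using (Fin)
open import Data.Bool using (Bool; true; false)
open import Data.Product using (Σ; _×_; _,_; proj₁; proj₂; swap)
open import Data.Sum using (_⊎_)
open import Data.Vec using (Vec)
open import Data.List using (List; length)
open import Data.List.Membership.Propositional using (_∈_)
open import Relation.Binary.PropositionalEquality using (_≡_; _≢_)

-- Nodes are Fin n, (undirected) edges are Fin m with endpoints `ends e`
-- and integer capacity `cap e ≥ 1`; sessions are Fin k with source,
-- sink and demand (number of sub-packets) `dem i ≥ 1`.
record Instance : Set where
  field
    n   : ℕ
    m   : ℕ
    ends : Fin m → Fin n × Fin n
    cap  : Fin m → ℕ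
    k    : ℕ
    src  : Fin k → Fin n
    snk  : Fin k → Fin n
    dem  : Fin k → ℕ

module _ (M : Instance) where
  open Instance M

  sender : Fin m → Bool → Fin n
  sender e true  = proj₁ (ends e)
  sender e false = proj₂ (ends e)

  receiver : Fin m → Bool → Fin n
  receiver e true  = proj₂ (ends e)
  receiver e false = proj₁ (ends e)

  data Reach (u : Fin n) : Fin n → Set where
    here : Reach u u
    step : ∀ {v} (e : Fin m) (dir : Bool) →
           Reach u (sender e dir) → receiver e dir ≡ v → Reach u v

  record WellFormed : Set where
    field
      noLoop     : ∀ e → proj₁ (ends e) ≢ proj₂ (ends e)
      noParallel : ∀ e e' → (ends e ≡ ends e' ⊎ ends e ≡ swap (ends e')) → e ≡ e'
      connected  : ∀ u v → Reach u v
      capPos     : ∀ e → 1 ≤ cap e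
      demPos     : ∀ i → 1 ≤ dem i

  Input : Set → Set
  Input A = (i : Fin k) → Vec A (dem i)

  -- message sent in round r (r = 0,1,2,...) along edge e in direction dir,
  -- as a function of the whole input; causality is imposed separately
  MsgFun : Set → Set
  MsgFun A = ℕ → (e : Fin m) → (dir : Bool) → Input A → Vec A (cap e)

  -- x and y are indistinguishable to node v after r rounds: same packets
  -- originating at v and same messages received in rounds 0..r-1
  SameView : {A : Set} → MsgFun A → Fin n → ℕ → Input A → Input A → Set
  SameView msg v zero    x y = ∀ i → src i ≡ v → x i ≡ y i
  SameView msg v (suc r) x y =
    SameView msg v r x y ×
    (∀ e dir → receiver e dir ≡ v → msg r e dir x ≡ msg r e dir y)

  -- a coding protocol: each message is a (predetermined) function of the
  -- sender's view, i.e. messages agree on inputs with the same view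
  record CodingProtocol (A : Set) : Set where
    field
      msg    : MsgFun A
      causal : ∀ r e dir x y →
               SameView msg (sender e dir) r x y → msg r e dir x ≡ msg r e dir y

  -- makespan at most T: after T rounds every sink t_i can determine
  -- the packet of s_i (its view determines x i)
  CodingMakespan≤ : {A : Set} → CodingProtocol A → ℕ → Set
  CodingMakespan≤ P T =
    ∀ i x y → SameView (CodingProtocol.msg P) (snk i) T x y → x i ≡ y i

  CodingAchieves : ℕ → Set
  CodingAchieves T =
    Σ ℕ λ q → 2 ≤ q × Σ (CodingProtocol (Fin q)) λ P → CodingMakespan≤ P T

  SubPacket : Set
  SubPacket = Σ (Fin k) λ i → Fin (dem i)

  Schedule : Set
  Schedule = ℕ → Fin m → Bool → List SubPacket

  Knows : Schedule → Fin n → ℕ → SubPacket → Set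
  Knows σ v zero    p = src (proj₁ p) ≡ v
  Knows σ v (suc r) p =
    Knows σ v r p ⊎
    (Σ (Fin m) λ e → Σ Bool λ dir → receiver e dir ≡ v × p ∈ σ r e dir)

  record RoutingProtocol : Set where
    field
      route    : Schedule
      capacity : ∀ r e dir → length (route r e dir) ≤ cap e
      forward  : ∀ r e dir p → p ∈ route r e dir → Knows route (sender e dir) r p

  RoutingMakespan≤ : RoutingProtocol → ℕ → Set
  RoutingMakespan≤ P T =
    ∀ i (j : Fin (dem i)) → Knows (RoutingProtocol.route P) (snk i) T (i , j)

  RoutingAchieves : ℕ → Set
  RoutingAchieves T = Σ RoutingProtocol λ P → RoutingMakespan≤ P T

{-# OPTIONS --safe #-}
-- A bottle with k sessions has terminals s i, t i and an edge u–v, joined by slots s i → u, v → t i and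
-- s i → t j for i ≠ j.  If the slots are links, coding sends the parity of all packets over u–v, and t i removes
-- the packets it gets from the other sources; without u–v the distance from s i to t i is three slots.
-- Nest this: the slots of level j + 1 bottles are the sessions of level j bottles, a level 0 session being an edge.
-- Two slots in sequence are used by the coding protocol, so its makespan only doubles with each level.
--
-- Which slots share a lower bottle is governed by involutions of a finite set (matrices modulo N) in which no
-- short reduced word fixes a point.  Hence a short walk lifts to a tree of bottles, and a potential defined
-- along the tree triples with each level: without the u–v edges, source and sink are 3ʰ apart.
-- Routing in fewer rounds must send every packet over some u–v edge, of which there are too few.
-- The gap is of order (3/2)ʰ while log k is at most of order 12ʰ, and 2⁷ · 12 ≤ 3⁷.
module Submission where

open import Defs
open import Data.Bool using (Bool; true; false; T; if_then_else_)
open import Data.Bool.Properties using (T-irrelevant)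
open import Data.Empty using (⊥; ⊥-elim)
open import Data.Fin using (Fin; zero; suc; toℕ; fromℕ; fromℕ<; inject₁)
open import Data.Fin.Induction using (<-weakInduction)
open import Data.Fin.Permutation using (↔⇒≡)
import Data.Fin.Properties as Finₚ
open import Data.Integer using (ℤ; ∣_∣) renaming (+_ to ⁺_; _+_ to _+ᶻ_; _*_ to _*ᶻ_; _-_ to _-ᶻ_; -_ to -ᶻ_; _/ℕ_ to _/ℕᶻ_)
import Data.Integer.DivMod as ℤ÷
import Data.Integer.Properties as ℤₚ
import Data.Integer.Tactic.RingSolver as ℤ-Solver
open import Data.List using (List; []; _∷_; length; _++_; concatMap; allFin; lookup)
open import Data.List.Membership.Propositional using (_∈_; lose)
import Data.List.Membership.Propositional.Properties as ∈ₚ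
import Data.List.Properties as Listₚ
open import Data.List.Relation.Unary.All using (All; []; _∷_)
open import Data.List.Relation.Unary.Any using (index)
import Data.List.Relation.Unary.Any.Properties as Anyₚ
open import Data.Maybe using (Maybe; just; nothing)
open import Data.Nat using (ℕ; zero; suc; _+_; _*_; _^_; _∸_; _⊓_; _⊔_; _≤_; _<_; z≤n; s≤s; z<s; s<s; ∣_-_∣; NonZero; ≢-nonZero; >-nonZero; _≤′_; ≤′-refl; ≤′-step)
open import Data.Nat.Logarithm using (⌊log₂_⌋; ⌊log₂⌋-mono-≤; ⌊log₂[2^n]⌋≡n)
import Data.Nat.Properties as ℕₚ
open import Data.Nat.Tactic.RingSolver using () renaming (solve-∀ to ℕ-solve-∀)
open import Data.Product using (Σ; _×_; _,_; proj₁; proj₂; swap)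
open import Data.Product.Function.NonDependent.Propositional using (_×-↔_)
open import Data.Sum using (_⊎_; inj₁; inj₂)
open import Data.Sum.Function.Propositional using (_⊎-↔_)
open import Data.Sum.Properties using (inj₂-injective)
open import Data.Unit using (⊤; tt)
open import Data.Vec as Vec using (Vec; []; _∷_)
open import Function using (_∘_)
open import Function.Bundles using (_↔_; Inverse; mk↔ₛ′)
open import Function.Properties.Inverse using (↔-trans; ↔-sym; ↔-refl)
open import Relation.Binary.Definitions using (DecidableEquality)
open import Relation.Binary.PropositionalEquality
open import Relation.Nullary using (¬_; Dec; yes; no)
open import Relation.Nullary.Decidable using (⌊_⌋; isYes; map′; toWitness; fromWitness)

-- Finite types

-- The obstacle is the number of u-v edges. If every slot had a lower bottle to itself, there would
-- be more bottles than sessions, and routing could use their u-v edges. So a lower bottle is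
-- shared: its κ j sessions replace slots of κ j different upper bottles, one for each position, and
-- bottles get wider towards the lower levels. Sharing closes cycles, and a cycle could be a
-- shortcut. Therefore everything is copied once for each element of a finite set `X`, and a joint
-- `a` connects copy `x` of the upper bottle to copy `act a x` of the lower one. This multiplies
-- sessions and u-v edges by the same factor, while cycles become too long to be closed in 3ʰ
-- rounds. The size of `X` costs only in log k. Widths are roughly squared from level to level, so
-- the logarithm of the number of joints is of order h · 2ʰ; separating words of length 3ʰ
-- multiplies this by 3ʰ. Hence log k and the gap are both exponential in h, and the gap is at least
-- of the order of a power of log k.

record Finite (A : Set) : Set where
  constructor finite
  field
    card    : ℕ
    counted : A ↔ Fin card

  enc : A → Fin card
  enc = Inverse.to counted

  dec : Fin card → A
  dec = Inverse.from counted

  dec∘enc : ∀ a → dec (enc a) ≡ a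
  dec∘enc = Inverse.strictlyInverseʳ counted

  enc∘dec : ∀ i → enc (dec i) ≡ i
  enc∘dec = Inverse.strictlyInverseˡ counted

  enc-injective : ∀ {a b} → enc a ≡ enc b → a ≡ b
  enc-injective {a} {b} eq = trans (sym (dec∘enc a)) (trans (cong dec eq) (dec∘enc b))

  dec-injective : ∀ {i j} → dec i ≡ dec j → i ≡ j
  dec-injective {i} {j} eq = trans (sym (enc∘dec i)) (trans (cong enc eq) (enc∘dec j))


open Finite using (card; enc; dec)

-- Some enumerations below are built by case analysis on the level and do not compute at a variable
-- one; their sizes are compared through bijections instead.
card-unique : ∀ {A B : Set} → A ↔ B → (F : Finite A) (G : Finite B) → card F ≡ card G
card-unique A↔B (finite _ F) (finite _ G) = ↔⇒≡ (↔-trans (↔-sym F) (↔-trans A↔B G))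

via : ∀ {A B : Set} → A ↔ B → Finite B → Finite A
via A↔B (finite n c) = finite n (↔-trans A↔B c)

Fin-finite : ∀ n → Finite (Fin n)
Fin-finite n = finite n ↔-refl

⊤-finite : Finite ⊤
⊤-finite = finite 1 (↔-sym Finₚ.1↔⊤)

Bool-finite : Finite Bool
Bool-finite = finite 2 (↔-sym Finₚ.2↔Bool)

¬-finite : ∀ {A : Set} → ¬ A → Finite A
¬-finite ¬a = finite 0 (mk↔ₛ′ (λ a → ⊥-elim (¬a a)) (λ ()) (λ ()) (λ a → ⊥-elim (¬a a)))

infixr 2 _×-finite_
infixr 1 _⊎-finite_

_×-finite_ : ∀ {A B : Set} → Finite A → Finite B → Finite (A × B)
finite m f ×-finite finite n g = finite (m * n) (↔-trans (f ×-↔ g) (↔-sym Finₚ.*↔×))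

_⊎-finite_ : ∀ {A B : Set} → Finite A → Finite B → Finite (A ⊎ B)
finite m f ⊎-finite finite n g = finite (m + n) (↔-trans (f ⊎-↔ g) (↔-sym Finₚ.+↔⊎))

sumBelow : ℕ → (ℕ → ℕ) → ℕ
sumBelow zero    f = 0
sumBelow (suc h) f = f 0 + sumBelow h (λ j → f (suc j))

sumBelow-bound : ∀ h y b (f : ℕ → ℕ) → (∀ j → j < h → y * f j ≤ b) → y * sumBelow h f ≤ h * b
sumBelow-bound zero    y b f _  = ℕₚ.≤-reflexive (ℕₚ.*-zeroʳ y)
sumBelow-bound (suc h) y b f le = begin
  y * (f 0 + sumBelow h (λ j → f (suc j)))      ≡⟨ ℕₚ.*-distribˡ-+ y (f 0) _ ⟩
  y * f 0 + y * sumBelow h (λ j → f (suc j))    ≤⟨ ℕₚ.+-mono-≤ (le 0 z<s) (sumBelow-bound h y b _ (λ j j<h → le (suc j) (s<s j<h))) ⟩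
  b + h * b                                     ∎
  where open ℕₚ.≤-Reasoning

Σℕ-split : ∀ (P : ℕ → Set) → Σ ℕ P ↔ (P 0 ⊎ Σ ℕ (λ j → P (suc j)))
Σℕ-split P = mk↔ₛ′ to from (λ { (inj₁ _) → refl ; (inj₂ _) → refl }) (λ { (zero , _) → refl ; (suc _ , _) → refl })
  where
  to : Σ ℕ P → P 0 ⊎ Σ ℕ (λ j → P (suc j))
  to (zero  , p) = inj₁ p
  to (suc j , p) = inj₂ (j , p)
  from : P 0 ⊎ Σ ℕ (λ j → P (suc j)) → Σ ℕ P
  from (inj₁ p)       = zero , p
  from (inj₂ (j , p)) = suc j , p

-- Lets levels be plain numbers: a family over all of them is finite once it is empty from `h` on.
Σℕ-finite : ∀ h (P : ℕ → Set) → (∀ j → Finite (P j)) → (∀ j → P j → j < h) → Finite (Σ ℕ P)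
Σℕ-finite zero    P fin <h = ¬-finite λ (j , p) → ℕₚ.n≮0 (<h j p)
Σℕ-finite (suc h) P fin <h =
  via (Σℕ-split P) (fin 0 ⊎-finite Σℕ-finite h _ (λ j → fin (suc j)) (λ j p → ℕₚ.≤-pred (<h (suc j) p)))

card-Σℕ-finite : ∀ h P fin <h → card (Σℕ-finite h P fin <h) ≡ sumBelow h (λ j → card (fin j))
card-Σℕ-finite zero    P fin <h = refl
card-Σℕ-finite (suc h) P fin <h = cong (card (fin 0) +_) (card-Σℕ-finite h _ _ _)

T-finite : ∀ b → Finite (T b)
T-finite true  = ⊤-finite
T-finite false = ¬-finite (λ ())

card-T-finite≤1 : ∀ b → card (T-finite b) ≤ 1
card-T-finite≤1 true  = ℕₚ.≤-refl
card-T-finite≤1 false = z≤n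

Fin-split : ∀ {n} (P : Fin (suc n) → Set) → Σ (Fin (suc n)) P ↔ (P zero ⊎ Σ (Fin n) (λ j → P (suc j)))
Fin-split {n} P = mk↔ₛ′ to from (λ { (inj₁ _) → refl ; (inj₂ _) → refl }) (λ { (zero , _) → refl ; (suc _ , _) → refl })
  where
  to : Σ (Fin (suc n)) P → P zero ⊎ Σ (Fin n) (λ j → P (suc j))
  to (zero  , p) = inj₁ p
  to (suc j , p) = inj₂ (j , p)
  from : P zero ⊎ Σ (Fin n) (λ j → P (suc j)) → Σ (Fin (suc n)) P
  from (inj₁ p)       = zero , p
  from (inj₂ (j , p)) = suc j , p

Fin-subset-finite : ∀ n (p : Fin n → Bool) → Finite (Σ (Fin n) (λ i → T (p i)))
Fin-subset-finite zero    p = ¬-finite (λ ())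
Fin-subset-finite (suc n) p = via (Fin-split _) (T-finite (p zero) ⊎-finite Fin-subset-finite n (λ i → p (suc i)))

card-Fin-subset-finite : ∀ n p → card (Fin-subset-finite n p) ≤ n
card-Fin-subset-finite zero    p = z≤n
card-Fin-subset-finite (suc n) p = ℕₚ.+-mono-≤ (card-T-finite≤1 (p zero)) (card-Fin-subset-finite n _)

-- Involutions without short relations

NotHead : ∀ {B : Set} → B → List B → Set
NotHead a []      = ⊤
NotHead a (b ∷ _) = a ≢ b

-- Letters will act as involutions, so each is its own inverse and free reduction forbids only equal
-- neighbours.
Reduced : ∀ {B : Set} → List B → Set
Reduced []      = ⊤
Reduced (a ∷ w) = NotHead a w × Reduced w

run : ∀ {B X : Set} → (B → X → X) → List B → X → X
run act []      x = x
run act (a ∷ w) x = act a (run act w x)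

-- Joining `x` to `act b x` for every `b` gives the Schreier graph of the action; `free` says that
-- its girth exceeds `L`.
record FreeInvolutions (B : Set) (L : ℕ) : Set₁ where
  field
    X          : Set
    X-finite   : Finite X
    basepoint  : X
    act        : B → X → X
    involutive : ∀ b x → act b (act b x) ≡ x
    free       : ∀ w → Reduced w → length w ≤ L → ∀ x → run act w x ≡ x → w ≡ []

-- Flips of integer rows and the ping-pong argument

Row : Set
Row = ℤ × ℤ

-- Conjugate of the coordinate swap by the a-th power of the shear (y , z) ↦ (y , z + 2y).
flip : ℕ → Row → Row
flip a (y , z) = z +ᶻ ⁺ 2 *ᶻ ⁺ a *ᶻ y , y -ᶻ ⁺ 2 *ᶻ ⁺ a *ᶻ (z +ᶻ ⁺ 2 *ᶻ ⁺ a *ᶻ y)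

flip-involutive : ∀ a v → flip a (flip a v) ≡ v
flip-involutive a (y , z) = cong₂ _,_ (first (⁺ a) y z) (second (⁺ a) y z)
  where
  first : ∀ a y z → (y -ᶻ ⁺ 2 *ᶻ a *ᶻ (z +ᶻ ⁺ 2 *ᶻ a *ᶻ y)) +ᶻ ⁺ 2 *ᶻ a *ᶻ (z +ᶻ ⁺ 2 *ᶻ a *ᶻ y) ≡ y
  first = ℤ-Solver.solve-∀
  second : ∀ a y z → (z +ᶻ ⁺ 2 *ᶻ a *ᶻ y) -ᶻ ⁺ 2 *ᶻ a *ᶻ ((y -ᶻ ⁺ 2 *ᶻ a *ᶻ (z +ᶻ ⁺ 2 *ᶻ a *ᶻ y)) +ᶻ ⁺ 2 *ᶻ a *ᶻ (z +ᶻ ⁺ 2 *ᶻ a *ᶻ y)) ≡ z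
  second = ℤ-Solver.solve-∀

combine : ℤ → ℤ → Row → Row → Row
combine c d (y , z) (y′ , z′) = c *ᶻ y +ᶻ d *ᶻ y′ , c *ᶻ z +ᶻ d *ᶻ z′

flip-combine : ∀ a c d v v′ → flip a (combine c d v v′) ≡ combine c d (flip a v) (flip a v′)
flip-combine a c d (y , z) (y′ , z′) = cong₂ _,_ (first (⁺ a) c d y z y′ z′) (second (⁺ a) c d y z y′ z′)
  where
  first : ∀ a c d y z y′ z′ →
    (c *ᶻ z +ᶻ d *ᶻ z′) +ᶻ ⁺ 2 *ᶻ a *ᶻ (c *ᶻ y +ᶻ d *ᶻ y′) ≡
    c *ᶻ (z +ᶻ ⁺ 2 *ᶻ a *ᶻ y) +ᶻ d *ᶻ (z′ +ᶻ ⁺ 2 *ᶻ a *ᶻ y′)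
  first = ℤ-Solver.solve-∀
  second : ∀ a c d y z y′ z′ →
    (c *ᶻ y +ᶻ d *ᶻ y′) -ᶻ ⁺ 2 *ᶻ a *ᶻ ((c *ᶻ z +ᶻ d *ᶻ z′) +ᶻ ⁺ 2 *ᶻ a *ᶻ (c *ᶻ y +ᶻ d *ᶻ y′)) ≡
    c *ᶻ (y -ᶻ ⁺ 2 *ᶻ a *ᶻ (z +ᶻ ⁺ 2 *ᶻ a *ᶻ y)) +ᶻ d *ᶻ (y′ -ᶻ ⁺ 2 *ᶻ a *ᶻ (z′ +ᶻ ⁺ 2 *ᶻ a *ᶻ y′))
  second = ℤ-Solver.solve-∀

-- Linearity lets the effect of a word on the two rows of an invertible matrix decide its effect on
-- `unitRow`.
run-flip-combine : ∀ w c d v v′ → run flip w (combine c d v v′) ≡ combine c d (run flip w v) (run flip w v′)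
run-flip-combine []      c d v v′ = refl
run-flip-combine (a ∷ w) c d v v′ =
  trans (cong (flip a) (run-flip-combine w c d v v′)) (flip-combine a c d _ _)

Dominated : ℕ → Row → Set
Dominated a (y , z) = ∣ z +ᶻ ⁺ 2 *ᶻ ⁺ a *ᶻ y ∣ < ∣ y ∣

-- Ping-pong: after undoing the last shear the first coordinate dominates, and a shear by a nonzero multiple reverses this.
dominates-more : ∀ (n y z : ℤ) → n ≢ ⁺ 0 → ∣ z ∣ < ∣ y ∣ → ∣ y ∣ < ∣ z +ᶻ ⁺ 2 *ᶻ n *ᶻ y ∣
dominates-more n y z n≢0 z<y = ℕₚ.+-cancelʳ-< ∣ z ∣ ∣ y ∣ _ (begin-strict
  ∣ y ∣ + ∣ z ∣                                       <⟨ ℕₚ.+-monoʳ-< ∣ y ∣ z<y ⟩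
  ∣ y ∣ + ∣ y ∣                                       ≡⟨ cong (∣ y ∣ +_) (ℕₚ.+-identityʳ ∣ y ∣) ⟨
  2 * ∣ y ∣                                           ≤⟨ ℕₚ.*-monoˡ-≤ ∣ y ∣ (ℕₚ.*-monoʳ-≤ 2 (ℕₚ.n≢0⇒n>0 (n≢0 ∘ ℤₚ.∣i∣≡0⇒i≡0))) ⟩
  2 * ∣ n ∣ * ∣ y ∣                                 ≡⟨ cong (_* ∣ y ∣) (ℤₚ.abs-* (⁺ 2) n) ⟨
  ∣ ⁺ 2 *ᶻ n ∣ * ∣ y ∣                                ≡⟨ ℤₚ.abs-* (⁺ 2 *ᶻ n) y ⟨
  ∣ ⁺ 2 *ᶻ n *ᶻ y ∣                                     ≡⟨ cong ∣_∣ (regroup z (⁺ 2 *ᶻ n *ᶻ y)) ⟩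
  ∣ (z +ᶻ ⁺ 2 *ᶻ n *ᶻ y) -ᶻ z ∣                          ≤⟨ ℤₚ.∣i-j∣≤∣i∣+∣j∣ (z +ᶻ ⁺ 2 *ᶻ n *ᶻ y) z ⟩
  ∣ z +ᶻ ⁺ 2 *ᶻ n *ᶻ y ∣ + ∣ z ∣                      ∎)
  where
  open ℕₚ.≤-Reasoning
  regroup : ∀ z t → t ≡ (z +ᶻ t) -ᶻ z
  regroup = ℤ-Solver.solve-∀

-- Shearing by `b` is shearing by `a` and then by the nonzero difference, which makes the second
-- coordinate the larger one; the swap inside `flip b` then puts it first.
flip-dominated : ∀ a b v → b ≢ a → Dominated a v → Dominated b (flip b v)
flip-dominated a b (y , z) b≢a dom =
  subst₂ _<_ (cong ∣_∣ (undo (⁺ b) y z)) (cong ∣_∣ (shift (⁺ a) (⁺ b) y z))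
    (dominates-more (⁺ b -ᶻ ⁺ a) y (z +ᶻ ⁺ 2 *ᶻ ⁺ a *ᶻ y) (b≢a ∘ ℤₚ.+-injective ∘ ℤₚ.i-j≡0⇒i≡j (⁺ b) (⁺ a)) dom)
  where
  undo : ∀ b y z → y ≡ (y -ᶻ ⁺ 2 *ᶻ b *ᶻ (z +ᶻ ⁺ 2 *ᶻ b *ᶻ y)) +ᶻ ⁺ 2 *ᶻ b *ᶻ (z +ᶻ ⁺ 2 *ᶻ b *ᶻ y)
  undo = ℤ-Solver.solve-∀
  shift : ∀ a b y z → (z +ᶻ ⁺ 2 *ᶻ a *ᶻ y) +ᶻ ⁺ 2 *ᶻ (b -ᶻ a) *ᶻ y ≡ z +ᶻ ⁺ 2 *ᶻ b *ᶻ y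
  shift = ℤ-Solver.solve-∀

unitRow : Row
unitRow = ⁺ 0 , ⁺ 1

run-flip-dominated : ∀ a w → Reduced (a ∷ w) → Dominated a (run flip (a ∷ w) unitRow)
run-flip-dominated a [] _ = subst₂ _<_ (cong ∣_∣ (sym (start (⁺ a)))) (cong ∣_∣ (sym (one (⁺ a)))) (s≤s z≤n)
  where
  start : ∀ a → (⁺ 0 -ᶻ ⁺ 2 *ᶻ a *ᶻ (⁺ 1 +ᶻ ⁺ 2 *ᶻ a *ᶻ ⁺ 0)) +ᶻ ⁺ 2 *ᶻ a *ᶻ (⁺ 1 +ᶻ ⁺ 2 *ᶻ a *ᶻ ⁺ 0) ≡ ⁺ 0
  start = ℤ-Solver.solve-∀
  one : ∀ a → ⁺ 1 +ᶻ ⁺ 2 *ᶻ a *ᶻ ⁺ 0 ≡ ⁺ 1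
  one = ℤ-Solver.solve-∀
run-flip-dominated b (a ∷ w) (b≢a , red) = flip-dominated a b (run flip (a ∷ w) unitRow) b≢a (run-flip-dominated a w red)

run-flip≢0 : ∀ a w → Reduced (a ∷ w) → proj₁ (run flip (a ∷ w) unitRow) ≢ ⁺ 0
run-flip≢0 a w red eq = ℕₚ.n≮0 (subst (∣ z +ᶻ ⁺ 2 *ᶻ ⁺ a *ᶻ y ∣ <_) (cong ∣_∣ eq) (run-flip-dominated a w red))
  where
  y z : ℤ
  y = proj₁ (run flip (a ∷ w) unitRow)
  z = proj₂ (run flip (a ∷ w) unitRow)

module Bounds (A : ℕ) where
  base : ℕ
  base = suc (2 * A)

  Bounded : ℕ → Row → Set
  Bounded m (y , z) = ∣ y ∣ ≤ m × ∣ z ∣ ≤ m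

  shear-bound : ∀ m a y z → a ≤ A → ∣ y ∣ ≤ m → ∣ z ∣ ≤ m → ∣ z +ᶻ ⁺ 2 *ᶻ ⁺ a *ᶻ y ∣ ≤ base * m
  shear-bound m a y z a≤A y≤m z≤m = begin
    ∣ z +ᶻ ⁺ 2 *ᶻ ⁺ a *ᶻ y ∣        ≤⟨ ℤₚ.∣i+j∣≤∣i∣+∣j∣ z _ ⟩
    ∣ z ∣ + ∣ ⁺ 2 *ᶻ ⁺ a *ᶻ y ∣   ≡⟨ cong (∣ z ∣ +_) (trans (ℤₚ.abs-* (⁺ 2 *ᶻ ⁺ a) y) (cong (_* ∣ y ∣) (ℤₚ.abs-* (⁺ 2) (⁺ a)))) ⟩
    ∣ z ∣ + 2 * a * ∣ y ∣     ≤⟨ ℕₚ.+-mono-≤ z≤m (ℕₚ.*-mono-≤ (ℕₚ.*-monoʳ-≤ 2 a≤A) y≤m) ⟩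
    base * m                      ∎
    where open ℕₚ.≤-Reasoning

  flip-bounded : ∀ m a v → a ≤ A → Bounded m v → Bounded (base * (base * m)) (flip a v)
  flip-bounded m a (y , z) a≤A (y≤m , z≤m) = ℕₚ.≤-trans fst≤ (ℕₚ.m≤m+n _ _) , (begin
    ∣ y -ᶻ ⁺ 2 *ᶻ ⁺ a *ᶻ t ∣                 ≤⟨ ℤₚ.∣i-j∣≤∣i∣+∣j∣ y _ ⟩
    ∣ y ∣ + ∣ ⁺ 2 *ᶻ ⁺ a *ᶻ t ∣            ≡⟨ cong (∣ y ∣ +_) (trans (ℤₚ.abs-* (⁺ 2 *ᶻ ⁺ a) t) (cong (_* ∣ t ∣) (ℤₚ.abs-* (⁺ 2) (⁺ a)))) ⟩
    ∣ y ∣ + 2 * a * ∣ t ∣              ≤⟨ ℕₚ.+-mono-≤ (ℕₚ.≤-trans y≤m (ℕₚ.m≤m+n m _)) (ℕₚ.*-mono-≤ (ℕₚ.*-monoʳ-≤ 2 a≤A) fst≤) ⟩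
    base * (base * m)                    ∎)
    where
    open ℕₚ.≤-Reasoning
    t = z +ᶻ ⁺ 2 *ᶻ ⁺ a *ᶻ y
    fst≤ = shear-bound m a y z a≤A y≤m z≤m

  -- Each letter costs two factors of `base` because a flip contains two shears.
  bound : ℕ → ℕ
  bound zero    = 1
  bound (suc n) = base * (base * bound n)

  bound-mono : ∀ {m n} → m ≤ n → bound m ≤ bound n
  bound-mono {n = zero}  z≤n     = ℕₚ.≤-refl
  bound-mono {n = suc n} z≤n     = ℕₚ.≤-trans (bound-mono {n = n} z≤n) (ℕₚ.≤-trans (ℕₚ.m≤m+n _ _) (ℕₚ.m≤m+n _ _))
  bound-mono             (s≤s p) = ℕₚ.*-monoʳ-≤ base (ℕₚ.*-monoʳ-≤ base (bound-mono p))

  run-flip-bounded : ∀ w → All (_≤ A) w → Bounded (bound (length w)) (run flip w unitRow)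
  run-flip-bounded []      []         = z≤n , ℕₚ.≤-refl
  run-flip-bounded (a ∷ w) (a≤ ∷ all) = flip-bounded _ a (run flip w unitRow) a≤ (run-flip-bounded w all)

-- Flips modulo `N`

module Modular (N : ℕ) .{{_ : NonZero N}} where
  infix 4 _≈_ _≈²_ _≈?_
  infix 3 _by_

  -- With the quotient as data, the congruence laws become polynomial identities.
  record _≈_ (a b : ℤ) : Set where
    constructor _by_
    field
      quotient : ℤ
      equation : a ≡ b +ᶻ quotient *ᶻ ⁺ N

  ≈-reflexive : ∀ {a b} → a ≡ b → a ≈ b
  ≈-reflexive {a} refl = (⁺ 0) by lemma a (⁺ N)
    where
    lemma : ∀ a n → a ≡ a +ᶻ ⁺ 0 *ᶻ n
    lemma = ℤ-Solver.solve-∀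

  ≈-sym : ∀ {a b} → a ≈ b → b ≈ a
  ≈-sym {a} {b} (q by refl) = (-ᶻ q) by lemma b q (⁺ N)
    where
    lemma : ∀ b q n → b ≡ (b +ᶻ q *ᶻ n) +ᶻ (-ᶻ q) *ᶻ n
    lemma = ℤ-Solver.solve-∀

  ≈-trans : ∀ {a b c} → a ≈ b → b ≈ c → a ≈ c
  ≈-trans {c = c} (q by refl) (r by refl) = (r +ᶻ q) by lemma c q r (⁺ N)
    where
    lemma : ∀ c q r n → (c +ᶻ r *ᶻ n) +ᶻ q *ᶻ n ≡ c +ᶻ (r +ᶻ q) *ᶻ n
    lemma = ℤ-Solver.solve-∀

  +-cong : ∀ {a a′ b b′} → a ≈ a′ → b ≈ b′ → a +ᶻ b ≈ a′ +ᶻ b′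
  +-cong {a′ = a} {b′ = b} (q by refl) (r by refl) = (q +ᶻ r) by lemma a b q r (⁺ N)
    where
    lemma : ∀ a b q r n → (a +ᶻ q *ᶻ n) +ᶻ (b +ᶻ r *ᶻ n) ≡ (a +ᶻ b) +ᶻ (q +ᶻ r) *ᶻ n
    lemma = ℤ-Solver.solve-∀

  *-congˡ : ∀ c {a a′} → a ≈ a′ → c *ᶻ a ≈ c *ᶻ a′
  *-congˡ c {a′ = a} (q by refl) = (c *ᶻ q) by lemma a c q (⁺ N)
    where
    lemma : ∀ a c q n → c *ᶻ (a +ᶻ q *ᶻ n) ≡ c *ᶻ a +ᶻ (c *ᶻ q) *ᶻ n
    lemma = ℤ-Solver.solve-∀

  *-cong : ∀ {a a′ b b′} → a ≈ a′ → b ≈ b′ → a *ᶻ b ≈ a′ *ᶻ b′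
  *-cong {a} {a′} {b} {b′} a≈ b≈ =
    ≈-trans (*-congˡ a b≈) (subst₂ _≈_ (ℤₚ.*-comm b′ a) (ℤₚ.*-comm b′ a′) (*-congˡ b′ a≈))

  neg-cong : ∀ {a a′} → a ≈ a′ → -ᶻ a ≈ -ᶻ a′
  neg-cong {a′ = a} (q by refl) = (-ᶻ q) by lemma a q (⁺ N)
    where
    lemma : ∀ a q n → -ᶻ (a +ᶻ q *ᶻ n) ≡ -ᶻ a +ᶻ (-ᶻ q) *ᶻ n
    lemma = ℤ-Solver.solve-∀

  ≈0⇒≡0 : ∀ {a} → ∣ a ∣ < N → a ≈ ⁺ 0 → a ≡ ⁺ 0
  ≈0⇒≡0 {a} a<N (q by eq) = ℤₚ.∣i∣≡0⇒i≡0 (go ∣ q ∣ (trans (cong ∣_∣ (trans eq (ℤₚ.+-identityˡ (q *ᶻ ⁺ N)))) (ℤₚ.abs-* q (⁺ N))))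
    where
    go : ∀ m → ∣ a ∣ ≡ m * N → ∣ a ∣ ≡ 0
    go zero    e = e
    go (suc m) e = ⊥-elim (ℕₚ.<⇒≱ a<N (subst (N ≤_) (sym e) (ℕₚ.m≤m+n N _)))

  residue : ℤ → Fin N
  residue z = fromℕ< (ℤ÷.n%ℕd<d z N)

  lift : Fin N → ℤ
  lift i = ⁺ toℕ i

  lift-residue : ∀ z → lift (residue z) ≈ z
  lift-residue z = ≈-sym ((z /ℕᶻ N) by
    trans (ℤ÷.a≡a%ℕn+[a/ℕn]*n z N) (cong (λ r → ⁺ r +ᶻ (z /ℕᶻ N) *ᶻ ⁺ N) (sym (Finₚ.toℕ-fromℕ< (ℤ÷.n%ℕd<d z N)))))

  lift-injective : ∀ {i j} → lift i ≈ lift j → i ≡ j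
  lift-injective {i} {j} i≈j = Finₚ.toℕ-injective (ℤₚ.+-injective (ℤₚ.i-j≡0⇒i≡j (lift i) (lift j) (≈0⇒≡0 small diff)))
    where
    diff : lift i -ᶻ lift j ≈ ⁺ 0
    diff = ≈-trans (+-cong i≈j (≈-reflexive { -ᶻ lift j} refl)) (≈-reflexive (ℤₚ.i≡j⇒i-j≡0 {lift j} refl))
    small : ∣ lift i -ᶻ lift j ∣ < N
    small = ℕₚ.≤-<-trans
      (subst (λ d → ∣ d ∣ ≤ toℕ i ⊔ toℕ j) (sym (ℤₚ.[+m]-[+n]≡m⊖n (toℕ i) (toℕ j))) (ℤₚ.∣m⊝n∣≤m⊔n (toℕ i) (toℕ j)))
      (ℕₚ.⊔-lub (Finₚ.toℕ<n i) (Finₚ.toℕ<n j))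

  _≈?_ : ∀ a b → Dec (a ≈ b)
  a ≈? b = map′
    (λ eq → ≈-trans (≈-sym (lift-residue a)) (≈-trans (≈-reflexive (cong lift eq)) (lift-residue b)))
    (λ a≈b → lift-injective (≈-trans (lift-residue a) (≈-trans a≈b (≈-sym (lift-residue b)))))
    (residue a Finₚ.≟ residue b)

  record _≈²_ (v w : Row) : Set where
    constructor _,_
    field
      first≈  : proj₁ v ≈ proj₁ w
      second≈ : proj₂ v ≈ proj₂ w

  flip-cong : ∀ a {v v′} → v ≈² v′ → flip a v ≈² flip a v′
  flip-cong a (y≈ , z≈) = shear≈ , +-cong y≈ (neg-cong (*-congˡ (⁺ 2 *ᶻ ⁺ a) shear≈))
    where shear≈ = +-cong z≈ (*-congˡ (⁺ 2 *ᶻ ⁺ a) y≈)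

  combine-cong : ∀ c d {v v′ w w′} → v ≈² v′ → w ≈² w′ → combine c d v w ≈² combine c d v′ w′
  combine-cong c d (y≈ , z≈) (y′≈ , z′≈) =
    +-cong (*-congˡ c y≈) (*-congˡ d y′≈) , +-cong (*-congˡ c z≈) (*-congˡ d z′≈)

  ModRow : Set
  ModRow = Fin N × Fin N

  residue² : Row → ModRow
  residue² (y , z) = residue y , residue z

  lift² : ModRow → Row
  lift² (y , z) = lift y , lift z

  lift²-residue² : ∀ v → lift² (residue² v) ≈² v
  lift²-residue² (y , z) = lift-residue y , lift-residue z

  lift²-injective : ∀ {r r′} → lift² r ≈² lift² r′ → r ≡ r′
  lift²-injective (y≈ , z≈) = cong₂ _,_ (lift-injective y≈) (lift-injective z≈)

  ≈²-trans : ∀ {v w x} → v ≈² w → w ≈² x → v ≈² x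
  ≈²-trans (p , q) (p′ , q′) = ≈-trans p p′ , ≈-trans q q′

  ≈²-sym : ∀ {v w} → v ≈² w → w ≈² v
  ≈²-sym (p , q) = ≈-sym p , ≈-sym q

  ≈²-reflexive : ∀ {v w} → v ≡ w → v ≈² w
  ≈²-reflexive refl = ≈-reflexive refl , ≈-reflexive refl

  modFlip : ℕ → ModRow → ModRow
  modFlip a r = residue² (flip a (lift² r))

  modFlip-involutive : ∀ a r → modFlip a (modFlip a r) ≡ r
  modFlip-involutive a r = lift²-injective
    (≈²-trans (lift²-residue² (flip a (lift² (modFlip a r))))
    (≈²-trans (flip-cong a (lift²-residue² (flip a (lift² r))))
              (≈²-reflexive (flip-involutive a (lift² r)))))

  lift²-run : ∀ w r → lift² (run modFlip w r) ≈² run flip w (lift² r)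
  lift²-run []      r = ≈²-reflexive refl
  lift²-run (a ∷ w) r = ≈²-trans (lift²-residue² _) (flip-cong a (lift²-run w r))

  det : Row → Row → ℤ
  det (p , q) (r , s) = p *ᶻ s -ᶻ r *ᶻ q

  det-cong : ∀ {v v′ w w′} → v ≈² v′ → w ≈² w′ → det v w ≈ det v′ w′
  det-cong (p , q) (r , s) = +-cong (*-cong p s) (neg-cong (*-cong r q))

  -- A flip is conjugate to a swap and has determinant -1, so only the square is invariant; hence
  -- the square in `Unimodular`.
  det²-flip : ∀ a v w → det (flip a v) (flip a w) *ᶻ det (flip a v) (flip a w) ≡ det v w *ᶻ det v w
  det²-flip a (p , q) (r , s) = lemma (⁺ a) p q r s
    where
    lemma : ∀ a p q r s →
      ((q +ᶻ ⁺ 2 *ᶻ a *ᶻ p) *ᶻ (r -ᶻ ⁺ 2 *ᶻ a *ᶻ (s +ᶻ ⁺ 2 *ᶻ a *ᶻ r)) -ᶻ (s +ᶻ ⁺ 2 *ᶻ a *ᶻ r) *ᶻ (p -ᶻ ⁺ 2 *ᶻ a *ᶻ (q +ᶻ ⁺ 2 *ᶻ a *ᶻ p)))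
      *ᶻ ((q +ᶻ ⁺ 2 *ᶻ a *ᶻ p) *ᶻ (r -ᶻ ⁺ 2 *ᶻ a *ᶻ (s +ᶻ ⁺ 2 *ᶻ a *ᶻ r)) -ᶻ (s +ᶻ ⁺ 2 *ᶻ a *ᶻ r) *ᶻ (p -ᶻ ⁺ 2 *ᶻ a *ᶻ (q +ᶻ ⁺ 2 *ᶻ a *ᶻ p)))
      ≡ (p *ᶻ s -ᶻ r *ᶻ q) *ᶻ (p *ᶻ s -ᶻ r *ᶻ q)
    lemma = ℤ-Solver.solve-∀

  Unimodular : ModRow × ModRow → Set
  Unimodular (v , w) = det (lift² v) (lift² w) *ᶻ det (lift² v) (lift² w) ≈ ⁺ 1

  unimodular? : ∀ m → Dec (Unimodular m)
  unimodular? (v , w) = det (lift² v) (lift² w) *ᶻ det (lift² v) (lift² w) ≈? ⁺ 1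

  modFlip-unimodular : ∀ a v w → Unimodular (v , w) → Unimodular (modFlip a v , modFlip a w)
  modFlip-unimodular a v w uni =
    ≈-trans (*-cong det≈ det≈) (≈-trans (≈-reflexive (det²-flip a (lift² v) (lift² w))) uni)
    where
    det≈ : det (lift² (modFlip a v)) (lift² (modFlip a w)) ≈ det (flip a (lift² v)) (flip a (lift² w))
    det≈ = det-cong (lift²-residue² (flip a (lift² v))) (lift²-residue² (flip a (lift² w)))

  -- An invertible matrix fixed by a word forces the word itself to fix the second unit row modulo N.
  fixed⇒≈0 : ∀ w v v′ → Unimodular (v , v′) → run modFlip w v ≡ v → run modFlip w v′ ≡ v′ →
             proj₁ (run flip w unitRow) ≈ ⁺ 0
  fixed⇒≈0 w v@(p , q) v′@(r , s) uni fix fix′ =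
    -- Modulo `N`, `d` is its own inverse, so it is enough that `d * Y` vanishes.
    ≈-trans (≈-reflexive (sym (ℤₚ.*-identityˡ Y)))
    (≈-trans (*-cong (≈-sym uni) (≈-reflexive {Y} refl))
    (≈-trans (≈-reflexive (regroup d Y))
    (≈-trans (*-congˡ d dY≈0) (≈-reflexive (ℤₚ.*-zeroʳ d)))))
    where
    d Y : ℤ
    d = det (lift² v) (lift² v′)
    Y = proj₁ (run flip w unitRow)
    -- The second row of the adjugate applied to the matrix, which gives `d` times `unitRow`.
    c : Row
    c = combine (-ᶻ lift r) (lift p) (lift² v) (lift² v′)
    c-fixed : run flip w c ≈² c
    c-fixed = ≈²-trans (≈²-reflexive (run-flip-combine w (-ᶻ lift r) (lift p) (lift² v) (lift² v′)))
      (combine-cong (-ᶻ lift r) (lift p)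
        (≈²-trans (≈²-sym (lift²-run w v)) (≈²-reflexive (cong lift² fix)))
        (≈²-trans (≈²-sym (lift²-run w v′)) (≈²-reflexive (cong lift² fix′))))
    c≡ : c ≡ combine d (⁺ 0) unitRow unitRow
    c≡ = cong₂ _,_ (first (lift p) (lift r) d) (second (lift p) (lift q) (lift r) (lift s))
      where
      first : ∀ p r d → (-ᶻ r) *ᶻ p +ᶻ p *ᶻ r ≡ d *ᶻ ⁺ 0 +ᶻ ⁺ 0 *ᶻ ⁺ 0
      first = ℤ-Solver.solve-∀
      second : ∀ p q r s → (-ᶻ r) *ᶻ q +ᶻ p *ᶻ s ≡ (p *ᶻ s -ᶻ r *ᶻ q) *ᶻ ⁺ 1 +ᶻ ⁺ 0 *ᶻ ⁺ 1
      second = ℤ-Solver.solve-∀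
    dY≈0 : d *ᶻ Y ≈ ⁺ 0
    dY≈0 = ≈-trans (≈-reflexive (pad d Y))
      (≈-trans (≈-reflexive (cong proj₁ (trans (sym (run-flip-combine w d (⁺ 0) unitRow unitRow)) (cong (run flip w) (sym c≡)))))
      (≈-trans (_≈²_.first≈ c-fixed) (≈-reflexive (zero-first (lift p) (lift r)))))
      where
      pad : ∀ d Y → d *ᶻ Y ≡ d *ᶻ Y +ᶻ ⁺ 0 *ᶻ Y
      pad = ℤ-Solver.solve-∀
      zero-first : ∀ p r → (-ᶻ r) *ᶻ p +ᶻ p *ᶻ r ≡ ⁺ 0
      zero-first = ℤ-Solver.solve-∀
    regroup : ∀ d Y → d *ᶻ d *ᶻ Y ≡ d *ᶻ (d *ᶻ Y)
    regroup = ℤ-Solver.solve-∀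

subset-finite : ∀ {A : Set} (F : Finite A) (p : A → Bool) → Finite (Σ A (λ a → T (p a)))
subset-finite {A} F p = via iso (Fin-subset-finite (card F) (λ i → p (dec F i)))
  where
  ext : ∀ {B : Set} (p : B → Bool) {x y : Σ B (λ a → T (p a))} → proj₁ x ≡ proj₁ y → x ≡ y
  ext p {a , u} {.a , v} refl = cong (a ,_) (T-irrelevant u v)
  iso : Σ A (λ a → T (p a)) ↔ Σ (Fin (card F)) (λ i → T (p (dec F i)))
  iso = mk↔ₛ′
    (λ (a , u) → enc F a , subst (λ b → T (p b)) (sym (Finite.dec∘enc F a)) u)
    (λ (i , u) → dec F i , u)
    (λ (i , u) → ext (λ i → p (dec F i)) (Finite.enc∘dec F i))
    (λ (a , u) → ext p (Finite.dec∘enc F a))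

card-subset-finite : ∀ {A : Set} (F : Finite A) (p : A → Bool) → card (subset-finite F p) ≤ card F
card-subset-finite F p = card-Fin-subset-finite (card F) (λ i → p (dec F i))

-- The free action on unimodular matrices

module _ (A L : ℕ) where
  open Bounds A

  -- Exceeds every coordinate that a word of length at most `L` can give to `unitRow`, so such a
  -- coordinate vanishes modulo it only if it is 0.
  modulus : ℕ
  modulus = suc (bound L)

  open Modular modulus

  -- Single rows would not do: the zero row is fixed by every word. A fixed invertible matrix, in
  -- contrast, pins down the action of the word on all rows. The condition is Boolean so that a
  -- matrix is determined by its entries.
  Matrices : Set
  Matrices = Σ (ModRow × ModRow) (λ m → T ⌊ unimodular? m ⌋)

  ModMatrix-finite : Finite (ModRow × ModRow)
  ModMatrix-finite = (Fin-finite _ ×-finite Fin-finite _) ×-finite (Fin-finite _ ×-finite Fin-finite _)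

  Matrices-finite : Finite Matrices
  Matrices-finite = subset-finite ModMatrix-finite (λ m → ⌊ unimodular? m ⌋)

  card-Matrices : card Matrices-finite ≤ (modulus * modulus) * (modulus * modulus)
  card-Matrices = card-subset-finite ModMatrix-finite (λ m → ⌊ unimodular? m ⌋)

  flipMatrix : Fin A → Matrices → Matrices
  flipMatrix a ((v , w) , uni) =
    (modFlip (toℕ a) v , modFlip (toℕ a) w) , fromWitness (modFlip-unimodular (toℕ a) v w (toWitness uni))

  Matrices-≡ : ∀ {m m′ : Matrices} → proj₁ m ≡ proj₁ m′ → m ≡ m′
  Matrices-≡ {m , u} {.m , u′} refl = cong (m ,_) (T-irrelevant u u′)

  flipMatrix-involutive : ∀ a m → flipMatrix a (flipMatrix a m) ≡ m
  flipMatrix-involutive a ((v , w) , _) =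
    Matrices-≡ (cong₂ _,_ (modFlip-involutive (toℕ a) v) (modFlip-involutive (toℕ a) w))

  identityMatrix : Matrices
  identityMatrix = ((residue (⁺ 1) , residue (⁺ 0)) , (residue (⁺ 0) , residue (⁺ 1))) ,
    fromWitness (≈-trans (*-cong one one) (≈-reflexive refl))
    where
    one = det-cong (lift²-residue² (⁺ 1 , ⁺ 0)) (lift²-residue² (⁺ 0 , ⁺ 1))

  module _ {B : Set} (code : B → Fin A) (code-injective : ∀ {a b} → code a ≡ code b → a ≡ b) where

    codes : List B → List ℕ
    codes []      = []
    codes (b ∷ w) = toℕ (code b) ∷ codes w

    codes-bounded : ∀ w → All (_≤ A) (codes w)
    codes-bounded []      = []
    codes-bounded (b ∷ w) = ℕₚ.<⇒≤ (Finₚ.toℕ<n (code b)) ∷ codes-bounded w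

    length-codes : ∀ w → length (codes w) ≡ length w
    length-codes []      = refl
    length-codes (b ∷ w) = cong suc (length-codes w)

    codes-reduced : ∀ w → Reduced w → Reduced (codes w)
    codes-reduced []          _           = tt
    codes-reduced (a ∷ [])    (_ , red)   = tt , tt
    codes-reduced (a ∷ b ∷ w) (a≢b , red) = (a≢b ∘ code-injective ∘ Finₚ.toℕ-injective) , codes-reduced (b ∷ w) red

    run-flipMatrix : ∀ w m → proj₁ (run (flipMatrix ∘ code) w m) ≡
      (run modFlip (codes w) (proj₁ (proj₁ m)) , run modFlip (codes w) (proj₂ (proj₁ m)))
    run-flipMatrix []      m = refl
    run-flipMatrix (b ∷ w) m =
      cong (λ (v , v′) → modFlip (toℕ (code b)) v , modFlip (toℕ (code b)) v′) (run-flipMatrix w m)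

    flipMatrix-free : ∀ w → Reduced w → length w ≤ L → ∀ m → run (flipMatrix ∘ code) w m ≡ m → w ≡ []
    flipMatrix-free []      _   _   _ _   = refl
    flipMatrix-free (b ∷ w) red len ((v , v′) , uni) fix =
      ⊥-elim (run-flip≢0 (toℕ (code b)) (codes w) (codes-reduced (b ∷ w) red)
        (≈0⇒≡0 small (fixed⇒≈0 (codes (b ∷ w)) v v′ (toWitness uni) (cong proj₁ rows) (cong proj₂ rows))))
      where
      rows = trans (sym (run-flipMatrix (b ∷ w) ((v , v′) , uni))) (cong proj₁ fix)
      small : ∣ proj₁ (run flip (codes (b ∷ w)) unitRow) ∣ < modulus
      small = s≤s (ℕₚ.≤-trans (proj₁ (run-flip-bounded (codes (b ∷ w)) (codes-bounded (b ∷ w))))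
        (bound-mono (subst (_≤ L) (sym (length-codes (b ∷ w))) len)))

    matrixInvolutions : FreeInvolutions B L
    matrixInvolutions = record
      { X          = Matrices
      ; X-finite   = Matrices-finite
      ; basepoint  = identityMatrix
      ; act        = flipMatrix ∘ code
      ; involutive = λ b → flipMatrix-involutive (code b)
      ; free       = flipMatrix-free
      }

-- Bottles and their potentials

-- Moves from α towards β by at most n units.
toward : ℕ → ℕ → ℕ → ℕ
toward zero    β       n = β ⊓ n
toward (suc α) zero    n = suc α ∸ n
toward (suc α) (suc β) n = suc (toward α β n)

toward-zero : ∀ α β → toward α β 0 ≡ α
toward-zero zero    β       = ℕₚ.⊓-zeroʳ β
toward-zero (suc α) zero    = refl
toward-zero (suc α) (suc β) = cong suc (toward-zero α β)

toward-reaches : ∀ α β n → ∣ α - β ∣ ≤ n → toward α β n ≡ β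
toward-reaches zero    β       n le = ℕₚ.m≤n⇒m⊓n≡m le
toward-reaches (suc α) zero    n le = ℕₚ.m≤n⇒m∸n≡0 le
toward-reaches (suc α) (suc β) n le = cong suc (toward-reaches α β n le)

⊓-lipschitz : ∀ β m n → ∣ β ⊓ m - β ⊓ n ∣ ≤ ∣ m - n ∣
⊓-lipschitz zero    m       n       = z≤n
⊓-lipschitz (suc β) zero    n       = ℕₚ.m⊓n≤n (suc β) n
⊓-lipschitz (suc β) (suc m) zero    = s≤s (ℕₚ.m⊓n≤n β m)
⊓-lipschitz (suc β) (suc m) (suc n) = ⊓-lipschitz β m n

∣a-a∸n∣≤n : ∀ a n → ∣ a - a ∸ n ∣ ≤ n
∣a-a∸n∣≤n a n = subst (_≤ n) (sym (ℕₚ.m≤n⇒∣n-m∣≡n∸m (ℕₚ.m∸n≤m a n)))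
  (ℕₚ.m≤n+o⇒m∸n≤o a (a ∸ n) (subst (a ≤_) (ℕₚ.+-comm n (a ∸ n)) (ℕₚ.m≤n+m∸n a n)))

∸-lipschitz : ∀ α m n → ∣ α ∸ m - α ∸ n ∣ ≤ ∣ m - n ∣
∸-lipschitz α       zero    n       = ∣a-a∸n∣≤n α n
∸-lipschitz α       (suc m) zero    = subst (_≤ suc m) (ℕₚ.∣-∣-comm α (α ∸ suc m)) (∣a-a∸n∣≤n α (suc m))
∸-lipschitz zero    (suc m) (suc n) = z≤n
∸-lipschitz (suc α) (suc m) (suc n) = ∸-lipschitz α m n

toward-lipschitz : ∀ α β m n → ∣ toward α β m - toward α β n ∣ ≤ ∣ m - n ∣
toward-lipschitz zero    β       = ⊓-lipschitz β
toward-lipschitz (suc α) zero    = ∸-lipschitz (suc α)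
toward-lipschitz (suc α) (suc β) = toward-lipschitz α β

data Terminal (k : ℕ) : Set where
  s t : Fin k → Terminal k
  u v : Terminal k

data Slot (k : ℕ) : Set where
  side : Fin k → Fin k → Slot k
  out  : Fin k → Slot k

sideTarget : ∀ {k} {i j : Fin k} → Dec (i ≡ j) → Terminal k
sideTarget {j = j} (yes _) = u
sideTarget {j = j} (no _)  = t j

slotSrc slotTgt : ∀ {k} → Slot k → Terminal k
slotSrc (side i j) = s i
slotSrc (out i)    = v
slotTgt (side i j) = sideTarget (i Finₚ.≟ j)
slotTgt (out i)    = t i

_≟ˢ_ : ∀ {k} → DecidableEquality (Slot k)
side i j ≟ˢ side i′ j′ with i Finₚ.≟ i′ | j Finₚ.≟ j′
... | yes refl | yes refl = yes refl
... | no i≢    | _        = no λ { refl → i≢ refl }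
... | _        | no j≢    = no λ { refl → j≢ refl }
side _ _ ≟ˢ out _    = no λ ()
out _    ≟ˢ side _ _ = no λ ()
out i    ≟ˢ out i′   = map′ (cong out) (λ { refl → refl }) (i Finₚ.≟ i′)

-- Distance from s i in a bottle without its u–v edge, every slot counting 1.
rank : ∀ {k} → Fin k → Terminal k → ℕ
rank i (s l) = if isYes (i Finₚ.≟ l) then 0 else 2
rank i (t l) = if isYes (i Finₚ.≟ l) then 3 else 1
rank i u     = 1
rank i v     = 2

rank-s : ∀ {k} (i : Fin k) → rank i (s i) ≡ 0
rank-s i with i Finₚ.≟ i
... | yes _   = refl
... | no i≢i = ⊥-elim (i≢i refl)

rank-t : ∀ {k} (i : Fin k) → rank i (t i) ≡ 3
rank-t i with i Finₚ.≟ i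
... | yes _   = refl
... | no i≢i = ⊥-elim (i≢i refl)

rank-slot : ∀ {k} (i : Fin k) e → ∣ rank i (slotSrc e) - rank i (slotTgt e) ∣ ≤ 1
rank-slot i (side l m) with l Finₚ.≟ m
rank-slot i (side l m) | yes _ with i Finₚ.≟ l
... | yes _ = s≤s z≤n
... | no _  = s≤s z≤n
rank-slot i (side l m) | no l≢m with i Finₚ.≟ l | i Finₚ.≟ m
... | yes refl | yes refl = ⊥-elim (l≢m refl)
... | yes _    | no _     = s≤s z≤n
... | no _     | yes _    = s≤s z≤n
... | no _     | no _     = s≤s z≤n
rank-slot i (out l) with i Finₚ.≟ l
... | yes _ = s≤s z≤n
... | no _  = s≤s z≤n

-- The variation allowed along one slot. A slot of level `suc j` is a session of level `j`, hence
-- `3 ^ j`. Level 0 has no slots in the network, and 1 is a value there that keeps both inequalities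
-- below.
scale : ℕ → ℕ
scale zero    = 1
scale (suc j) = 3 ^ j

scale≤3^ : ∀ j → scale j ≤ 3 ^ j
scale≤3^ zero    = ℕₚ.≤-refl
scale≤3^ (suc j) = ℕₚ.m≤m+n _ _

3^≤3*scale : ∀ j → 3 ^ j ≤ 3 * scale j
3^≤3*scale zero    = s≤s z≤n
3^≤3*scale (suc j) = ℕₚ.≤-refl

-- Nothing is required between `u` and `v`, so a potential bounds only walks that avoid the middle
-- edges.
record Potential (j : ℕ) {k : ℕ} (f : Terminal k → ℕ) : Set where
  field
    along-slot : ∀ e → ∣ f (slotSrc e) - f (slotTgt e) ∣ ≤ scale j
    across     : ∀ l → ∣ f (s l) - f (t l) ∣ ≤ 3 ^ j


open Potential

-- Continues a potential into a lower bottle entered through its session `i`, whose ends already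
-- carry `α` and `β`. It grows or falls with `rank i` and stops at `β`, which three slots are enough
-- to reach.
descend : ∀ {k} → ℕ → Fin k → ℕ → ℕ → Terminal k → ℕ
descend j i α β p = toward α β (rank i p * scale j)

descend-s : ∀ {k} j (i : Fin k) α β → descend j i α β (s i) ≡ α
descend-s j i α β = trans (cong (λ r → toward α β (r * scale j)) (rank-s i)) (toward-zero α β)

descend-t : ∀ {k} j (i : Fin k) α β → ∣ α - β ∣ ≤ 3 ^ j → descend j i α β (t i) ≡ β
descend-t j i α β le = trans (cong (λ r → toward α β (r * scale j)) (rank-t i))
  (toward-reaches α β _ (ℕₚ.≤-trans le (3^≤3*scale j)))

descend-lipschitz : ∀ {k} j (i : Fin k) α β p p′ → ∣ rank i p - rank i p′ ∣ ≤ 1 →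
                    ∣ descend j i α β p - descend j i α β p′ ∣ ≤ scale j
descend-lipschitz j i α β p p′ le = begin
  ∣ descend j i α β p - descend j i α β p′ ∣        ≤⟨ toward-lipschitz α β (rank i p * scale j) (rank i p′ * scale j) ⟩
  ∣ rank i p * scale j - rank i p′ * scale j ∣      ≡⟨ ℕₚ.*-distribʳ-∣-∣ (scale j) (rank i p) (rank i p′) ⟨
  ∣ rank i p - rank i p′ ∣ * scale j                ≤⟨ ℕₚ.*-monoˡ-≤ (scale j) le ⟩
  1 * scale j                                       ≡⟨ ℕₚ.*-identityˡ (scale j) ⟩
  scale j                                           ∎
  where open ℕₚ.≤-Reasoning

descend-potential : ∀ {k} j (i : Fin k) α β → ∣ α - β ∣ ≤ 3 ^ j → Potential j (descend j i α β)
along-slot (descend-potential j i α β le) e = descend-lipschitz j i α β (slotSrc e) (slotTgt e) (rank-slot i e)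
across     (descend-potential j i α β le) l with i Finₚ.≟ l
... | yes refl = subst (_≤ 3 ^ j) (sym (cong₂ ∣_-_∣ (toward-zero α β) (toward-reaches α β _ (ℕₚ.≤-trans le (3^≤3*scale j))))) le
-- The terminals of another session have ranks 2 and 1, so they differ by one slot at most.
... | no i≢l   = ℕₚ.≤-trans (toward-lipschitz α β (2 * scale j) (1 * scale j)) (begin
  ∣ 2 * scale j - 1 * scale j ∣   ≡⟨ ℕₚ.*-distribʳ-∣-∣ (scale j) 2 1 ⟨
  1 * scale j                     ≡⟨ ℕₚ.*-identityˡ (scale j) ⟩
  scale j                         ≤⟨ scale≤3^ j ⟩
  3 ^ j                           ∎)
  where open ℕₚ.≤-Reasoning

isSrc : ∀ {k} → Slot k → Terminal k → Bool
isSrc (side i _) (s l) = isYes (i Finₚ.≟ l)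
isSrc (out _)    v     = true
isSrc _          _     = false

isSrc-src : ∀ {k} (e : Slot k) → isSrc e (slotSrc e) ≡ true
isSrc-src (side i j) with i Finₚ.≟ i
... | yes _   = refl
... | no i≢i = ⊥-elim (i≢i refl)
isSrc-src (out i) = refl

isSrc-tgt : ∀ {k} (e : Slot k) → isSrc e (slotTgt e) ≡ false
isSrc-tgt (side i j) with i Finₚ.≟ j
... | yes _ = refl
... | no _  = refl
isSrc-tgt (out i) = refl

-- Continues a potential into the upper bottle that contains slot `e`. The values at the ends of `e`
-- differ by no more than any slot of that bottle may, so a step function with these two values is
-- already a potential.
ascend : ∀ {k} → Slot k → ℕ → ℕ → Terminal k → ℕ
ascend e α β p = if isSrc e p then α else β

ascend-potential : ∀ {k} j (e : Slot k) α β → ∣ α - β ∣ ≤ 3 ^ j → Potential (suc j) (ascend e α β)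
ascend-potential {k} j e α β le = record
  { along-slot = λ e′ → two (isSrc e (slotSrc e′)) (isSrc e (slotTgt e′))
  ; across     = λ l → ℕₚ.≤-trans (two (isSrc e (s l)) (isSrc e (t l))) (ℕₚ.m≤m+n (3 ^ j) _)
  }
  where
  two : ∀ b b′ → ∣ (if b then α else β) - (if b′ then α else β) ∣ ≤ 3 ^ j
  two true  true  = subst (_≤ 3 ^ j) (sym (ℕₚ.∣n-n∣≡0 α)) z≤n
  two true  false = le
  two false true  = subst (_≤ 3 ^ j) (ℕₚ.∣-∣-comm α β) le
  two false false = subst (_≤ 3 ^ j) (sym (ℕₚ.∣n-n∣≡0 β)) z≤n

-- Nested bottles and the tree covering them

module Bottles (h : ℕ) (κ : ℕ → ℕ) where

  -- A bottle of level j is a triple (es , is , x): es records the slots leading down to it from a top bottle, is the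
  -- positions to be taken below it.  Joint (j , es , e , i , is) makes slot e of (es , (i , is) , x) the i-th session
  -- of (es ▹ e , is , act x).
  data Context : ℕ → Set where
    top : Context h
    _▹_ : ∀ {j} → Context (suc j) → Slot (κ (suc j)) → Context j

  Positions : ℕ → Set
  Positions zero    = ⊤
  Positions (suc j) = Fin (κ j) × Positions j

  Joint : Set
  Joint = Σ ℕ λ j → Context (suc j) × Slot (κ (suc j)) × Fin (κ j) × Positions j

  module Paths (i₀ : Fin (κ h)) (is₀ : Positions h) where

    -- A vertex of the universal cover, given as a walk between bottles without backtracking; the
    -- last joint stands at the head of the word. The `NotHead` conditions make the word reduced.
    data Path : ∀ {j} → Context j → Positions j → List Joint → Set where
      root : Path top is₀ []
      down : ∀ {j} {es : Context (suc j)} {i is w} (e : Slot (κ (suc j))) →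
             Path es (i , is) w → NotHead (j , es , e , i , is) w →
             Path (es ▹ e) is ((j , es , e , i , is) ∷ w)
      up   : ∀ {j} {es : Context (suc j)} {e is w} (i : Fin (κ j)) →
             Path (es ▹ e) is w → NotHead (j , es , e , i , is) w →
             Path es (i , is) ((j , es , e , i , is) ∷ w)

    path-reduced : ∀ {j} {es : Context j} {is w} → Path es is w → Reduced w
    path-reduced root         = tt
    path-reduced (down e P n) = n , path-reduced P
    path-reduced (up i P n)   = n , path-reduced P

    val : ∀ {j} {es : Context j} {is w} → Path es is w → Terminal (κ j) → ℕ
    val root                   = descend h i₀ 0 (3 ^ h)
    val (down {j} {i = i} e P _) = descend j i (val P (slotSrc e)) (val P (slotTgt e))
    val (up {e = e} i P _)     = ascend e (val P (s i)) (val P (t i))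

    val-potential : ∀ {j} {es : Context j} {is w} (P : Path es is w) → Potential j (val P)
    val-potential root                   = descend-potential h i₀ 0 (3 ^ h) ℕₚ.≤-refl
    val-potential (down {j} {i = i} e P _) = descend-potential j i (val P (slotSrc e)) (val P (slotTgt e)) (along-slot (val-potential P) e)
    val-potential (up {j} {e = e} i P _) = ascend-potential j e _ _ (across (val-potential P) i)

    module _ {X : Set} (act : Joint → X → X) (involutive : ∀ a x → act a (act a x) ≡ x) (x₀ : X) where

      -- Passing through joint `a` either prolongs the word or cancels its head. In both cases the
      -- joined terminals keep their values, so links cost no potential and only wires change it.
      record Moved {j j′} {es : Context j} {is w} (P : Path es is w) (a : Joint)
                   (from-src from-tgt : Terminal (κ j)) (es′ : Context j′) (is′ : Positions j′)
                   (to-src to-tgt : Terminal (κ j′)) : Set where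
        constructor moved
        field
          {word}  : List Joint
          path    : Path es′ is′ word
          run≡    : run act word x₀ ≡ act a (run act w x₀)
          length≤ : length word ≤ suc (length w)
          src≡    : val path to-src ≡ val P from-src
          tgt≡    : val path to-tgt ≡ val P from-tgt

      move-down : ∀ {j} {es : Context (suc j)} {i is w} (P : Path es (i , is) w) (e : Slot (κ (suc j))) →
                  Moved P (j , es , e , i , is) (slotSrc e) (slotTgt e) (es ▹ e) is (s i) (t i)
      move-down {j} {es} {i} {is} P e = go P
        where
        push : ∀ {w} (P : Path es (i , is) w) → NotHead (j , es , e , i , is) w →
               Moved P (j , es , e , i , is) (slotSrc e) (slotTgt e) (es ▹ e) is (s i) (t i)
        push P n = moved (down e P n) refl ℕₚ.≤-refl (descend-s j i _ _)
          (descend-t j i (val P (slotSrc e)) (val P (slotTgt e)) (along-slot (val-potential P) e))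
        go : ∀ {w} (P : Path es (i , is) w) →
             Moved P (j , es , e , i , is) (slotSrc e) (slotTgt e) (es ▹ e) is (s i) (t i)
        go P@root           = push P tt
        go P@(down e′ Q n)  = push P (λ eq → ℕₚ.1+n≢n (sym (cong proj₁ eq)))
        -- Descending through the slot just climbed from undoes the last move and returns to `Q`;
        -- any other slot gives a new letter.
        go P@(up {e = e′} .i Q n) with e′ ≟ˢ e
        ... | yes refl = moved Q (sym (involutive _ _)) (ℕₚ.m≤n⇒m≤1+n (ℕₚ.n≤1+n _))
                (sym (cong (λ b → if b then val Q (s i) else val Q (t i)) (isSrc-src e)))
                (sym (cong (λ b → if b then val Q (s i) else val Q (t i)) (isSrc-tgt e)))
        ... | no e′≢e  = push P (λ { refl → e′≢e refl })

      move-up : ∀ {j} {es : Context (suc j)} {e is w} (P : Path (es ▹ e) is w) (i : Fin (κ j)) →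
                Moved P (j , es , e , i , is) (s i) (t i) es (i , is) (slotSrc e) (slotTgt e)
      move-up {j} {es} {e} {is} P i = go P
        where
        push : ∀ {w} (P : Path (es ▹ e) is w) → NotHead (j , es , e , i , is) w →
               Moved P (j , es , e , i , is) (s i) (t i) es (i , is) (slotSrc e) (slotTgt e)
        push P n = moved (up i P n) refl ℕₚ.≤-refl
          (cong (λ b → if b then val P (s i) else val P (t i)) (isSrc-src e))
          (cong (λ b → if b then val P (s i) else val P (t i)) (isSrc-tgt e))
        go : ∀ {w} (P : Path (es ▹ e) is w) →
             Moved P (j , es , e , i , is) (s i) (t i) es (i , is) (slotSrc e) (slotTgt e)
        go P@(up i′ Q n)  = push P (λ eq → ℕₚ.1+n≢n (cong proj₁ eq))
        go P@(down {i = i′} .e Q n) with i′ Finₚ.≟ i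
        ... | yes refl = moved Q (sym (involutive _ _)) (ℕₚ.m≤n⇒m≤1+n (ℕₚ.n≤1+n _))
                (sym (descend-s j i _ _)) (sym (descend-t j i (val Q (slotSrc e)) (val Q (slotTgt e)) (along-slot (val-potential Q) e)))
        ... | no i′≢i  = push P (λ { refl → i′≢i refl })

-- The network

Terminal-finite : ∀ k → Finite (Terminal k)
Terminal-finite k = via iso (Fin-finite k ⊎-finite Fin-finite k ⊎-finite Bool-finite)
  where
  iso : Terminal k ↔ (Fin k ⊎ Fin k ⊎ Bool)
  iso = mk↔ₛ′
    (λ { (s i) → inj₁ i ; (t i) → inj₂ (inj₁ i) ; u → inj₂ (inj₂ true) ; v → inj₂ (inj₂ false) })
    (λ { (inj₁ i) → s i ; (inj₂ (inj₁ i)) → t i ; (inj₂ (inj₂ true)) → u ; (inj₂ (inj₂ false)) → v })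
    (λ { (inj₁ i) → refl ; (inj₂ (inj₁ i)) → refl ; (inj₂ (inj₂ true)) → refl ; (inj₂ (inj₂ false)) → refl })
    (λ { (s i) → refl ; (t i) → refl ; u → refl ; v → refl })

Slot-finite : ∀ k → Finite (Slot k)
Slot-finite k = via iso ((Fin-finite k ×-finite Fin-finite k) ⊎-finite Fin-finite k)
  where
  iso : Slot k ↔ ((Fin k × Fin k) ⊎ Fin k)
  iso = mk↔ₛ′
    (λ { (side i j) → inj₁ (i , j) ; (out i) → inj₂ i })
    (λ { (inj₁ (i , j)) → side i j ; (inj₂ i) → out i })
    (λ { (inj₁ _) → refl ; (inj₂ _) → refl })
    (λ { (side _ _) → refl ; (out _) → refl })

module Finiteness (h : ℕ) (κ : ℕ → ℕ) where
  open Bottles h κ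

  context≤ : ∀ {j} → Context j → j ≤ h
  context≤ top      = ℕₚ.≤-refl
  context≤ (es ▹ e) = ℕₚ.≤-trans (ℕₚ.n≤1+n _) (context≤ es)

  context-top : Context h ↔ ⊤
  context-top = mk↔ₛ′ (λ _ → tt) (λ _ → top) (λ _ → refl) (only refl)
    where
    only : ∀ {j} (eq : j ≡ h) (es : Context j) → subst Context (sym eq) top ≡ es
    only refl top      = refl
    only refl (es ▹ e) = ⊥-elim (ℕₚ.1+n≰n (context≤ es))

  context-▹ : ∀ {j} → j < h → Context j ↔ (Context (suc j) × Slot (κ (suc j)))
  context-▹ {j} j<h = mk↔ₛ′ (to refl) (λ (es , e) → es ▹ e) (λ _ → refl) (from∘to refl)
    where
    to : ∀ {j′} → j′ ≡ j → Context j′ → Context (suc j′) × Slot (κ (suc j′))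
    to refl top      = ⊥-elim (ℕₚ.<-irrefl refl j<h)
    to refl (es ▹ e) = es , e
    from∘to : ∀ {j′} (eq : j′ ≡ j) (es : Context j′) → proj₁ (to eq es) ▹ proj₂ (to eq es) ≡ es
    from∘to refl top      = ⊥-elim (ℕₚ.<-irrefl refl j<h)
    from∘to refl (es ▹ e) = refl

  context-finite-upto : ∀ n j → n + j ≡ h → Finite (Context j)
  context-finite-upto zero    j refl = via context-top ⊤-finite
  context-finite-upto (suc n) j eq   =
    via (context-▹ (subst (suc j ≤_) eq (s≤s (ℕₚ.m≤n+m j n))))
      (context-finite-upto n (suc j) (trans (ℕₚ.+-suc n j) eq) ×-finite Slot-finite _)

  context-finite : ∀ j → Finite (Context j)
  context-finite j with j ℕₚ.≤? h
  ... | yes j≤h = context-finite-upto (h ∸ j) j (ℕₚ.m∸n+n≡m j≤h)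
  ... | no j≰h  = ¬-finite (j≰h ∘ context≤)

  positions-finite : ∀ j → Finite (Positions j)
  positions-finite zero    = ⊤-finite
  positions-finite (suc j) = Fin-finite (κ j) ×-finite positions-finite j

  opaque
    joint-finite : Finite Joint
    joint-finite = Σℕ-finite h _
      (λ j → context-finite (suc j) ×-finite Slot-finite _ ×-finite Fin-finite _ ×-finite positions-finite j)
      (λ j (es , _) → context≤ es)

    card-joint : card joint-finite ≡
      sumBelow h (λ j → card (context-finite (suc j)) * (card (Slot-finite (κ (suc j))) * (κ j * card (positions-finite j))))
    card-joint = card-Σℕ-finite h _ _ _

module Network (h : ℕ) (κ : ℕ → ℕ) (I : FreeInvolutions (Bottles.Joint h κ) (3 ^ h)) where
  open Bottles h κ
  open Finiteness h κ
  open FreeInvolutions I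

  Node : Set
  Node = Σ ℕ λ j → Context j × Positions j × X × Terminal (κ j)

  Middle : Set
  Middle = Σ ℕ λ j → Context (suc j) × Positions (suc j) × X

  Session : Set
  Session = Fin (κ h) × Positions h × X

  -- The ends of a slot and the terminals of the session that replaces it remain distinct nodes
  -- joined by links, so the vertex set needs no quotient. The Boolean tells the source link from
  -- the target link.
  data CoreEdge : Set where
    wire : Context 0 → X → Fin (κ 0) → CoreEdge
    mid  : Middle → CoreEdge
    link : Joint → X → Bool → CoreEdge

  upper lower : Joint → X → Bool → Node
  upper (j , es , e , i , is) x b = suc j , es , (i , is) , x , (if b then slotSrc e else slotTgt e)
  lower a@(j , es , e , i , is) x b = j , es ▹ e , is , act a x , (if b then s i else t i)

  coreEnds : CoreEdge → Node × Node
  coreEnds (wire es x i)             = (0 , es , tt , x , s i) , (0 , es , tt , x , t i)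
  coreEnds (mid (j , es , is , x))   = (suc j , es , is , x , u) , (suc j , es , is , x , v)
  coreEnds (link a x b)              = upper a x b , lower a x b

  -- Each node n = (n , fromℕ (3 ^ h)) has a path to a common hub, too long to matter for distances; (n , c) is c + 1 steps from the hub.
  Vertex : Set
  Vertex = ⊤ ⊎ (Node × Fin (suc (3 ^ h)))

  hub : Vertex
  hub = inj₁ tt

  core : Node → Vertex
  core n = inj₂ (n , fromℕ (3 ^ h))

  towardsHub : Node → Fin (suc (3 ^ h)) → Vertex
  towardsHub n zero    = hub
  towardsHub n (suc c) = inj₂ (n , inject₁ c)

  Edge : Set
  Edge = CoreEdge ⊎ (Node × Fin (suc (3 ^ h)))

  edgeEnds : Edge → Vertex × Vertex
  edgeEnds (inj₁ e)       = core (proj₁ (coreEnds e)) , core (proj₂ (coreEnds e))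
  edgeEnds (inj₂ (n , c)) = inj₂ (n , c) , towardsHub n c

  source sink : Session → Vertex
  source (i , is , x) = core (h , top , is , x , s i)
  sink   (i , is , x) = core (h , top , is , x , t i)

  opaque
    node-finite : Finite Node
    node-finite = Σℕ-finite (suc h) _
      (λ j → context-finite j ×-finite positions-finite j ×-finite X-finite ×-finite Terminal-finite _)
      (λ j (es , _) → s≤s (context≤ es))

    middle-finite : Finite Middle
    middle-finite = Σℕ-finite h _
      (λ j → context-finite (suc j) ×-finite positions-finite (suc j) ×-finite X-finite)
      (λ j (es , _) → context≤ es)

    session-finite : Finite Session
    session-finite = Fin-finite (κ h) ×-finite positions-finite h ×-finite X-finite

    card-middle : card middle-finite ≡
      sumBelow h (λ j → card (context-finite (suc j)) * (card (positions-finite (suc j)) * card X-finite))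
    card-middle = card-Σℕ-finite h _ _ _

    card-session : card session-finite ≡ κ h * (card (positions-finite h) * card X-finite)
    card-session = refl

    coreEdge-finite : Finite CoreEdge
    coreEdge-finite = via iso
      ((context-finite 0 ×-finite X-finite ×-finite Fin-finite (κ 0)) ⊎-finite
       middle-finite ⊎-finite (joint-finite ×-finite X-finite ×-finite Bool-finite))
      where
      iso : CoreEdge ↔ ((Context 0 × X × Fin (κ 0)) ⊎ Middle ⊎ (Joint × X × Bool))
      iso = mk↔ₛ′
        (λ { (wire es x i) → inj₁ (es , x , i) ; (mid m) → inj₂ (inj₁ m) ; (link a x b) → inj₂ (inj₂ (a , x , b)) })
        (λ { (inj₁ (es , x , i)) → wire es x i ; (inj₂ (inj₁ m)) → mid m ; (inj₂ (inj₂ (a , x , b))) → link a x b })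
        (λ { (inj₁ _) → refl ; (inj₂ (inj₁ _)) → refl ; (inj₂ (inj₂ _)) → refl })
        (λ { (wire _ _ _) → refl ; (mid _) → refl ; (link _ _ _) → refl })

    vertex-finite : Finite Vertex
    vertex-finite = ⊤-finite ⊎-finite node-finite ×-finite Fin-finite _

    edge-finite : Finite Edge
    edge-finite = coreEdge-finite ⊎-finite node-finite ×-finite Fin-finite _

  encᵛ : Vertex → Fin (card vertex-finite)
  encᵛ = enc vertex-finite

  encᵉ : Edge → Fin (card edge-finite)
  encᵉ = enc edge-finite

  decᵉ : Fin (card edge-finite) → Edge
  decᵉ = dec edge-finite

  M : Instance
  M = record
    { n    = card vertex-finite
    ; m    = card edge-finite
    ; ends = λ e → encᵛ (proj₁ (edgeEnds (decᵉ e))) , encᵛ (proj₂ (edgeEnds (decᵉ e)))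
    ; cap  = λ _ → 1
    ; k    = card session-finite
    ; src  = λ i → encᵛ (source (dec session-finite i))
    ; snk  = λ i → encᵛ (sink (dec session-finite i))
    ; dem  = λ _ → 1
    }

  tail head : Edge → Bool → Vertex
  tail e true  = proj₁ (edgeEnds e)
  tail e false = proj₂ (edgeEnds e)
  head e true  = proj₂ (edgeEnds e)
  head e false = proj₁ (edgeEnds e)

  sender-tail : ∀ e dir → sender M e dir ≡ encᵛ (tail (decᵉ e) dir)
  sender-tail e true  = refl
  sender-tail e false = refl

  receiver-head : ∀ e dir → receiver M e dir ≡ encᵛ (head (decᵉ e) dir)
  receiver-head e true  = refl
  receiver-head e false = refl

  level : Node → ℕ
  level = proj₁

  Shape : Set
  Shape = Σ ℕ λ j → Context j × Positions j × Terminal (κ j)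

  shape : Node → Shape
  shape (j , es , is , x , p) = j , es , is , p

  fibre : Node → X
  fibre (j , es , is , x , p) = x

  core-injective : ∀ {n n′} → core n ≡ core n′ → n ≡ n′
  core-injective refl = refl

  towardsHub≢core : ∀ n c n′ → towardsHub n c ≢ core n′
  towardsHub≢core n (suc c) n′ eq = Finₚ.fromℕ≢inject₁ (sym (cong proj₂ (inj₂-injective eq)))

  coreEnds-distinct : ∀ e → proj₁ (coreEnds e) ≢ proj₂ (coreEnds e)
  coreEnds-distinct (wire es x i)   ()
  coreEnds-distinct (mid m)         ()
  coreEnds-distinct (link a x b) eq = ℕₚ.1+n≢n (cong level eq)

  edgeEnds-distinct : ∀ e → proj₁ (edgeEnds e) ≢ proj₂ (edgeEnds e)
  edgeEnds-distinct (inj₁ e)             eq = coreEnds-distinct e (core-injective eq)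
  edgeEnds-distinct (inj₂ (n , suc c)) eq =
    ℕₚ.1+n≢n (trans (cong toℕ (cong proj₂ (inj₂-injective eq))) (Finₚ.toℕ-inject₁ c))

  -- The lower end names the joint, since its context ends in `e` and its terminal is numbered `i`.
  -- The upper end would not do, as many slots share an end.
  joint-shape : ∀ a a′ x x′ b b′ → shape (lower a x b) ≡ shape (lower a′ x′ b′) → a ≡ a′ × b ≡ b′
  joint-shape (j , es , e , i , is) (j′ , es′ , e′ , i′ , is′) x x′ true  true  refl = refl , refl
  joint-shape (j , es , e , i , is) (j′ , es′ , e′ , i′ , is′) x x′ false false refl = refl , refl
  joint-shape (j , es , e , i , is) (j′ , es′ , e′ , i′ , is′) x x′ true  false ()
  joint-shape (j , es , e , i , is) (j′ , es′ , e′ , i′ , is′) x x′ false true  ()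

  coreEnds-injective : ∀ e e′ → coreEnds e ≡ coreEnds e′ → e ≡ e′
  coreEnds-injective (wire es x i) (wire es′ x′ i′) refl = refl
  coreEnds-injective (wire es x i) (mid m)          ()
  coreEnds-injective (wire es x i) (link a x′ b)    eq   = ⊥-elim (ℕₚ.1+n≢n (trans (sym (cong (level ∘ proj₁) eq)) (cong (level ∘ proj₂) eq)))
  coreEnds-injective (mid m)       (wire es x i)    ()
  coreEnds-injective (mid m)       (mid m′)         refl = refl
  coreEnds-injective (mid m)       (link a x b)     eq   = ⊥-elim (ℕₚ.1+n≢n (trans (sym (cong (level ∘ proj₁) eq)) (cong (level ∘ proj₂) eq)))
  coreEnds-injective (link a x b)  (wire es x′ i)   eq   = ⊥-elim (ℕₚ.1+n≢n (trans (cong (level ∘ proj₁) eq) (sym (cong (level ∘ proj₂) eq))))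
  coreEnds-injective (link a x b)  (mid m)          eq   = ⊥-elim (ℕₚ.1+n≢n (trans (cong (level ∘ proj₁) eq) (sym (cong (level ∘ proj₂) eq))))
  coreEnds-injective (link a x b)  (link a′ x′ b′)  eq
    with joint-shape a a′ x x′ b b′ (cong (shape ∘ proj₂) eq) | cong (fibre ∘ proj₁) eq
  ... | refl , refl | refl = refl

  coreEnds-unswapped : ∀ e e′ → coreEnds e ≢ swap (coreEnds e′)
  coreEnds-unswapped (wire es x i) (wire es′ x′ i′) ()
  coreEnds-unswapped (wire es x i) (mid m)          ()
  coreEnds-unswapped (wire es x i) (link a x′ b)    eq = ℕₚ.1+n≢n (trans (sym (cong (level ∘ proj₂) eq)) (cong (level ∘ proj₁) eq))
  coreEnds-unswapped (mid m)       (wire es x i)    ()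
  coreEnds-unswapped (mid m)       (mid m′)         ()
  coreEnds-unswapped (mid m)       (link a x b)     eq = ℕₚ.1+n≢n (trans (sym (cong (level ∘ proj₂) eq)) (cong (level ∘ proj₁) eq))
  coreEnds-unswapped (link a x b)  (wire es x′ i)   eq = ℕₚ.1+n≢n (trans (cong (level ∘ proj₁) eq) (sym (cong (level ∘ proj₂) eq)))
  coreEnds-unswapped (link a x b)  (mid m)          eq = ℕₚ.1+n≢n (trans (cong (level ∘ proj₁) eq) (sym (cong (level ∘ proj₂) eq)))
  coreEnds-unswapped (link a x b)  (link a′ x′ b′)  eq =
    ℕₚ.m≢1+n+m (proj₁ a) {1} (trans (cong (level ∘ proj₂) eq) (cong suc (sym (cong (level ∘ proj₁) eq))))

  edgeEnds-injective : ∀ e e′ → edgeEnds e ≡ edgeEnds e′ → e ≡ e′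
  edgeEnds-injective (inj₁ e)       (inj₁ e′)        eq = cong inj₁ (coreEnds-injective e e′
    (cong₂ _,_ (core-injective (cong proj₁ eq)) (core-injective (cong proj₂ eq))))
  edgeEnds-injective (inj₁ e)       (inj₂ (n , c))   eq = ⊥-elim (towardsHub≢core n c _ (sym (cong proj₂ eq)))
  edgeEnds-injective (inj₂ (n , c)) (inj₁ e)         eq = ⊥-elim (towardsHub≢core n c _ (cong proj₂ eq))
  edgeEnds-injective (inj₂ _)       (inj₂ _)         eq = cong inj₂ (inj₂-injective (cong proj₁ eq))

  edgeEnds-unswapped : ∀ e e′ → edgeEnds e ≢ swap (edgeEnds e′)
  edgeEnds-unswapped (inj₁ e)           (inj₁ e′)          eq = coreEnds-unswapped e e′
    (cong₂ _,_ (core-injective (cong proj₁ eq)) (core-injective (cong proj₂ eq)))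
  edgeEnds-unswapped (inj₁ e)           (inj₂ (n , c))     eq = towardsHub≢core n c _ (sym (cong proj₁ eq))
  edgeEnds-unswapped (inj₂ (n , c))     (inj₁ e)           eq = towardsHub≢core n c _ (cong proj₂ eq)
  edgeEnds-unswapped (inj₂ (n , suc c)) (inj₂ (n′ , suc c′)) eq =
    ℕₚ.m≢1+n+m (toℕ c) {1} (trans (sym (Finₚ.toℕ-inject₁ c))
      (trans (cong toℕ (cong proj₂ (inj₂-injective (cong proj₂ eq))))
        (cong suc (trans (sym (Finₚ.toℕ-inject₁ c′)) (sym (cong toℕ (cong proj₂ (inj₂-injective (cong proj₁ eq)))))))))

  reach-trans : ∀ {a b c} → Reach M a b → Reach M b c → Reach M a c
  reach-trans p here              = p
  reach-trans p (step e dir q eq) = step e dir (reach-trans p q) eq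

  reach-along : ∀ e dir → Reach M (encᵛ (tail e dir)) (encᵛ (head e dir))
  reach-along e dir = step (encᵉ e) dir
    (subst (Reach M _) (sym (trans (sender-tail (encᵉ e) dir) (cong (λ e → encᵛ (tail e dir)) (Finite.dec∘enc edge-finite e)))) here)
    (trans (receiver-head (encᵉ e) dir) (cong (λ e → encᵛ (head e dir)) (Finite.dec∘enc edge-finite e)))

  reach-hub : ∀ w → Reach M (encᵛ w) (encᵛ hub) × Reach M (encᵛ hub) (encᵛ w)
  reach-hub (inj₁ tt)      = here , here
  reach-hub (inj₂ (n , c)) = <-weakInduction
    (λ c → Reach M (encᵛ (inj₂ (n , c))) (encᵛ hub) × Reach M (encᵛ hub) (encᵛ (inj₂ (n , c))))
    (reach-along (inj₂ (n , zero)) true , reach-along (inj₂ (n , zero)) false)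
    (λ c (to , from) → reach-trans (reach-along (inj₂ (n , suc c)) true) to ,
                       reach-trans from (reach-along (inj₂ (n , suc c)) false))
    c

  reach-all : ∀ w w′ → Reach M w w′
  reach-all w w′ = subst₂ (Reach M) (Finite.enc∘dec vertex-finite w) (Finite.enc∘dec vertex-finite w′)
    (reach-trans (proj₁ (reach-hub (dec vertex-finite w))) (proj₂ (reach-hub (dec vertex-finite w′))))

  encᵛ-injective : ∀ {w w′} → encᵛ w ≡ encᵛ w′ → w ≡ w′
  encᵛ-injective = Finite.enc-injective vertex-finite

  wellFormed : WellFormed M
  wellFormed = record
    { noLoop     = λ e eq → edgeEnds-distinct (decᵉ e) (encᵛ-injective eq)
    ; noParallel = noParallel
    ; connected  = reach-all
    ; capPos     = λ _ → s≤s z≤n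
    ; demPos     = λ _ → s≤s z≤n
    }
    where
    noParallel : ∀ e e′ → (Instance.ends M e ≡ Instance.ends M e′ ⊎ Instance.ends M e ≡ swap (Instance.ends M e′)) → e ≡ e′
    noParallel e e′ (inj₁ eq) = Finite.dec-injective edge-finite (edgeEnds-injective (decᵉ e) (decᵉ e′)
      (cong₂ _,_ (encᵛ-injective (cong proj₁ eq)) (encᵛ-injective (cong proj₂ eq))))
    noParallel e e′ (inj₂ eq) = ⊥-elim (edgeEnds-unswapped (decᵉ e) (decᵉ e′)
      (cong₂ _,_ (encᵛ-injective (cong proj₁ eq)) (encᵛ-injective (cong proj₂ eq))))

-- Routing

module Routing (h : ℕ) (κ : ℕ → ℕ) (I : FreeInvolutions (Bottles.Joint h κ) (3 ^ h)) where
  open Bottles h κ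
  open FreeInvolutions I
  open Network h κ I

  module Lifting (i₀ : Fin (κ h)) (is₀ : Positions h) (x₀ : X) where
    open Paths i₀ is₀

    -- Two bounds travel together: the one on the word is for freeness, the one on the potential for
    -- the distance. A node may have several lifts, and any one suffices.
    record Lifted (n : Node) (τ : ℕ) : Set where
      constructor lifted
      field
        {word}  : List Joint
        path    : Path (proj₁ (proj₂ n)) (proj₁ (proj₂ (proj₂ n))) word
        run≡    : run act word x₀ ≡ fibre n
        length≤ : length word ≤ τ
        val≤    : val path (proj₂ (proj₂ (proj₂ (proj₂ n)))) ≤ τ

    close-step : ∀ {a b τ} → ∣ a - b ∣ ≤ 1 → a ≤ τ → b ≤ suc τ
    close-step {a} {b} {τ} le a≤τ = begin
      b                ≤⟨ ℕₚ.m≤n+∣n-m∣ b a ⟩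
      a + ∣ a - b ∣    ≤⟨ ℕₚ.+-mono-≤ a≤τ le ⟩
      τ + 1            ≡⟨ ℕₚ.+-comm τ 1 ⟩
      suc τ            ∎
      where open ℕₚ.≤-Reasoning

    lifted-later : ∀ {n τ} → Lifted n τ → Lifted n (suc τ)
    lifted-later (lifted P r l v≤) = lifted P r (ℕₚ.m≤n⇒m≤1+n l) (ℕₚ.m≤n⇒m≤1+n v≤)

    lifted-wire : ∀ es x i {τ} → Lifted (0 , es , tt , x , s i) τ → Lifted (0 , es , tt , x , t i) (suc τ)
    lifted-wire es x i (lifted P r l v≤) =
      lifted P r (ℕₚ.m≤n⇒m≤1+n l) (close-step (across (val-potential P) i) v≤)

    lifted-wire⁻¹ : ∀ es x i {τ} → Lifted (0 , es , tt , x , t i) τ → Lifted (0 , es , tt , x , s i) (suc τ)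
    lifted-wire⁻¹ es x i (lifted P r l v≤) =
      lifted P r (ℕₚ.m≤n⇒m≤1+n l)
        (close-step (subst (_≤ 1) (ℕₚ.∣-∣-comm (val P (s i)) (val P (t i))) (across (val-potential P) i)) v≤)

    lifted-down : ∀ a x b {τ} → Lifted (upper a x b) τ → Lifted (lower a x b) (suc τ)
    lifted-down a@(j , es , e , i , is) x b (lifted P r l v≤) with b | move-down act involutive x₀ P e
    ... | true  | moved Q r′ l′ src≡ tgt≡ = lifted Q (trans r′ (cong (act a) r)) (ℕₚ.≤-trans l′ (s≤s l))
                                              (subst (_≤ _) (sym src≡) (ℕₚ.m≤n⇒m≤1+n v≤))
    ... | false | moved Q r′ l′ src≡ tgt≡ = lifted Q (trans r′ (cong (act a) r)) (ℕₚ.≤-trans l′ (s≤s l))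
                                              (subst (_≤ _) (sym tgt≡) (ℕₚ.m≤n⇒m≤1+n v≤))

    lifted-up : ∀ a x b {τ} → Lifted (lower a x b) τ → Lifted (upper a x b) (suc τ)
    lifted-up a@(j , es , e , i , is) x b (lifted P r l v≤) with b | move-up act involutive x₀ P i
    ... | true  | moved Q r′ l′ src≡ tgt≡ = lifted Q (trans r′ (trans (cong (act a) r) (involutive a x))) (ℕₚ.≤-trans l′ (s≤s l))
                                              (subst (_≤ _) (sym src≡) (ℕₚ.m≤n⇒m≤1+n v≤))
    ... | false | moved Q r′ l′ src≡ tgt≡ = lifted Q (trans r′ (trans (cong (act a) r) (involutive a x))) (ℕₚ.≤-trans l′ (s≤s l))
                                              (subst (_≤ _) (sym tgt≡) (ℕₚ.m≤n⇒m≤1+n v≤))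

    -- From round `3 ^ h` on nothing is claimed. Before that the hub is out of reach: at position
    -- `c` of a hub path at least `3 ^ h - c` rounds have been spent, and the lift is kept in case
    -- the packet turns back to the core.
    Reached : Vertex → ℕ → Set
    Reached (inj₁ tt)      τ = 3 ^ h ≤ τ
    Reached (inj₂ (n , c)) τ = 3 ^ h ≤ τ ⊎ (Lifted n τ × 3 ^ h ≤ toℕ c + τ)

    reached-later : ∀ w {τ} → Reached w τ → Reached w (suc τ)
    reached-later (inj₁ tt)      le               = ℕₚ.m≤n⇒m≤1+n le
    reached-later (inj₂ _)       (inj₁ le)        = inj₁ (ℕₚ.m≤n⇒m≤1+n le)
    reached-later (inj₂ (n , c)) (inj₂ (lf , le)) =
      inj₂ (lifted-later lf , ℕₚ.≤-trans le (ℕₚ.+-monoʳ-≤ (toℕ c) (ℕₚ.n≤1+n _)))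

    reached-core : ∀ n n′ {τ} → (Lifted n τ → Lifted n′ (suc τ)) → Reached (core n) τ → Reached (core n′) (suc τ)
    reached-core n n′ f (inj₁ le)        = inj₁ (ℕₚ.m≤n⇒m≤1+n le)
    reached-core n n′ f (inj₂ (lf , le)) = inj₂ (f lf , ℕₚ.≤-trans le (ℕₚ.+-monoʳ-≤ (toℕ (fromℕ (3 ^ h))) (ℕₚ.n≤1+n _)))

    reached-step : ∀ e dir {τ} → (∀ m → e ≢ inj₁ (mid m)) → Reached (tail e dir) τ → Reached (head e dir) (suc τ)
    reached-step (inj₁ (wire es x i)) true  _ = reached-core _ _ (lifted-wire es x i)
    reached-step (inj₁ (wire es x i)) false _ = reached-core _ _ (lifted-wire⁻¹ es x i)
    reached-step (inj₁ (mid m))       dir ¬mid = ⊥-elim (¬mid m refl)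
    reached-step (inj₁ (link a x b))  true  _ = reached-core _ _ (lifted-down a x b)
    reached-step (inj₁ (link a x b))  false _ = reached-core _ _ (lifted-up a x b)
    reached-step (inj₂ (n , zero))    true  _ (inj₁ le)        = ℕₚ.m≤n⇒m≤1+n le
    reached-step (inj₂ (n , zero))    true  _ (inj₂ (_ , le))  = ℕₚ.m≤n⇒m≤1+n le
    reached-step (inj₂ (n , suc c))   true  _ (inj₁ le)        = inj₁ (ℕₚ.m≤n⇒m≤1+n le)
    reached-step (inj₂ (n , suc c))   true  {τ} _ (inj₂ (lf , le)) =
      inj₂ (lifted-later lf , subst (3 ^ h ≤_) (trans (sym (ℕₚ.+-suc (toℕ c) τ)) (cong (_+ suc τ) (sym (Finₚ.toℕ-inject₁ c)))) le)
    reached-step (inj₂ (n , zero))    false _ le               = inj₁ (ℕₚ.m≤n⇒m≤1+n le)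
    reached-step (inj₂ (n , suc c))   false _ (inj₁ le)        = inj₁ (ℕₚ.m≤n⇒m≤1+n le)
    reached-step (inj₂ (n , suc c))   false {τ} _ (inj₂ (lf , le)) =
      inj₂ (lifted-later lf , ℕₚ.≤-trans le (ℕₚ.+-mono-≤ (ℕₚ.≤-trans (ℕₚ.≤-reflexive (Finₚ.toℕ-inject₁ c)) (ℕₚ.n≤1+n _)) (ℕₚ.n≤1+n τ)))

    reached-source : Reached (source (i₀ , is₀ , x₀)) 0
    reached-source = inj₂ (lifted root refl z≤n (ℕₚ.≤-reflexive (descend-s h i₀ 0 (3 ^ h))) ,
      ℕₚ.≤-reflexive (sym (trans (ℕₚ.+-identityʳ _) (Finₚ.toℕ-fromℕ (3 ^ h)))))

    trivial-path : ∀ {j} {es : Context j} {is w} (P : Path es is w) → w ≡ [] →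
                   (j≡h : j ≡ h) → val P (t (subst (Fin ∘ κ) (sym j≡h) i₀)) ≡ 3 ^ h
    trivial-path root refl refl = descend-t h i₀ 0 (3 ^ h) ℕₚ.≤-refl

    reached-sink : ∀ {τ} → Reached (sink (i₀ , is₀ , x₀)) τ → 3 ^ h ≤ τ
    reached-sink (inj₁ le) = le
    reached-sink {τ} (inj₂ (lifted {w} P r l v≤ , _)) with τ ℕₚ.≤? 3 ^ h
    -- The word fixes `x₀` and is short, so freeness makes it empty; the path is then `root`, whose
    -- potential at the sink is `3 ^ h`.
    ... | yes τ≤ = subst (_≤ τ) (trivial-path P (free w (path-reduced P) (ℕₚ.≤-trans l τ≤) x₀ r) refl) v≤
    ... | no τ≰  = ℕₚ.<⇒≤ (ℕₚ.≰⇒> τ≰)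

  middle? : ∀ (e : Edge) → (Σ Middle λ m → e ≡ inj₁ (mid m)) ⊎ (∀ m → e ≢ inj₁ (mid m))
  middle? (inj₁ (wire _ _ _)) = inj₂ λ _ ()
  middle? (inj₁ (mid m))      = inj₁ (m , refl)
  middle? (inj₁ (link _ _ _)) = inj₂ λ _ ()
  middle? (inj₂ _)            = inj₂ λ _ ()

  module _ (P : RoutingProtocol M) where
    open RoutingProtocol P

    middle : Fin (card middle-finite) → Fin (card edge-finite)
    middle f = encᵉ (inj₁ (mid (dec middle-finite f)))

    crossing : ℕ → Fin (card middle-finite) → List (SubPacket M)
    crossing r f = route r (middle f) true ++ route r (middle f) false

    crossings : ℕ → List (SubPacket M)
    crossings zero    = []
    crossings (suc r) = concatMap (crossing r) (allFin _) ++ crossings r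

    length-crossing : ∀ r f → length (crossing r f) ≤ 2
    length-crossing r f = subst (_≤ 2) (sym (Listₚ.length-++ (route r (middle f) true)))
      (ℕₚ.+-mono-≤ (capacity r (middle f) true) (capacity r (middle f) false))

    length-concatMap : ∀ {A B : Set} (g : A → List B) (c : ℕ) → (∀ a → length (g a) ≤ c) →
                       ∀ as → length (concatMap g as) ≤ length as * c
    length-concatMap g c le []       = z≤n
    length-concatMap g c le (a ∷ as) = subst (_≤ _) (sym (Listₚ.length-++ (g a)))
      (ℕₚ.+-mono-≤ (le a) (length-concatMap g c le as))

    length-crossings : ∀ r → length (crossings r) ≤ r * (card middle-finite * 2)
    length-crossings zero    = z≤n
    length-crossings (suc r) = subst (_≤ _) (sym (Listₚ.length-++ (concatMap (crossing r) (allFin _))))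
      (ℕₚ.+-mono-≤
        (subst (λ n → length (concatMap (crossing r) (allFin _)) ≤ n * 2) (Listₚ.length-tabulate {n = card middle-finite} (λ f → f))
          (length-concatMap (crossing r) 2 (length-crossing r) (allFin _)))
        (length-crossings r))

    ∈-crossings : ∀ {p} r m dir → p ∈ route r (encᵉ (inj₁ (mid m))) dir → p ∈ crossings (suc r)
    ∈-crossings {p} r m dir p∈ = ∈ₚ.∈-++⁺ˡ (∈ₚ.∈-concatMap⁺ (crossing r)
      (lose (∈ₚ.∈-allFin (enc middle-finite m)) (in-crossing dir p∈′)))
      where
      p∈′ : p ∈ route r (middle (enc middle-finite m)) dir
      p∈′ = subst (λ m → p ∈ route r (encᵉ (inj₁ (mid m))) dir) (sym (Finite.dec∘enc middle-finite m)) p∈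
      in-crossing : ∀ dir {f} → p ∈ route r (middle f) dir → p ∈ crossing r f
      in-crossing true  q = ∈ₚ.∈-++⁺ˡ q
      in-crossing false q = ∈ₚ.∈-++⁺ʳ _ q

    module _ (σ : Fin (card session-finite)) (d : Fin 1) where
      open Lifting (proj₁ (dec session-finite σ)) (proj₁ (proj₂ (dec session-finite σ))) (proj₂ (proj₂ (dec session-finite σ)))

      -- Routing only forwards, so knowledge of a packet traces back along a walk from its source.
      -- Either the packet has used a middle edge, or the walk is subject to the potential.
      knows⇒reached : ∀ r w → Knows M route (encᵛ w) r (σ , d) → (σ , d) ∈ crossings r ⊎ Reached w r
      knows⇒reached zero    w src≡ = inj₂ (subst (λ w → Reached w 0) (encᵛ-injective src≡) reached-source)
      knows⇒reached (suc r) w (inj₁ known) with knows⇒reached r w known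
      ... | inj₁ crossed = inj₁ (∈ₚ.∈-++⁺ʳ _ crossed)
      ... | inj₂ reached = inj₂ (reached-later w reached)
      knows⇒reached (suc r) w (inj₂ (e , dir , rcv≡ , p∈))
        with knows⇒reached r (tail (decᵉ e) dir) (subst (λ z → Knows M route z r (σ , d)) (sender-tail e dir) (forward r e dir (σ , d) p∈))
      ... | inj₁ crossed = inj₁ (∈ₚ.∈-++⁺ʳ _ crossed)
      ... | inj₂ reached with middle? (decᵉ e)
      ...   | inj₁ (m , eq) = inj₁ (∈-crossings r m dir
                (subst (λ e → (σ , d) ∈ route r e dir) (trans (sym (Finite.enc∘dec edge-finite e)) (cong encᵉ eq)) p∈))
      ...   | inj₂ ¬mid = inj₂ (subst (λ w → Reached w (suc r)) (encᵛ-injective (trans (sym (receiver-head e dir)) rcv≡))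
                (reached-step (decᵉ e) dir ¬mid reached))

    all-crossed : ∀ T → T < 3 ^ h → RoutingMakespan≤ M P T → ∀ σ → (σ , zero) ∈ crossings T
    all-crossed T T< fast σ with knows⇒reached σ zero T (sink (dec session-finite σ)) (fast σ zero)
    ... | inj₁ crossed = crossed
    ... | inj₂ reached = ⊥-elim (ℕₚ.<⇒≱ T< (Lifting.reached-sink _ _ _ reached))

    -- Packets of different sessions are different entries of one list, whose length is limited by
    -- two directions per middle edge and round.
    sessions≤crossings : ∀ T → T < 3 ^ h → RoutingMakespan≤ M P T → card session-finite ≤ T * (card middle-finite * 2)
    sessions≤crossings T T< fast = ℕₚ.≤-trans (Finₚ.injective⇒≤ {f = λ σ → index (all-crossed T T< fast σ)} inj) (length-crossings T)
      where
      inj : ∀ {σ σ′} → index (all-crossed T T< fast σ) ≡ index (all-crossed T T< fast σ′) → σ ≡ σ′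
      inj {σ} {σ′} eq = cong proj₁ (trans (Anyₚ.lookup-index (all-crossed T T< fast σ))
        (trans (cong (lookup (crossings T)) eq) (sym (Anyₚ.lookup-index (all-crossed T T< fast σ′)))))

  routing-makespan : card middle-finite * 2 * 3 ^ h ≤ card session-finite → 1 ≤ card session-finite →
                     ∀ T → RoutingAchieves M T → 3 ^ h ≤ T
  routing-makespan few some T (P , fast) with 3 ^ h ℕₚ.≤? T
  ... | yes le = le
  ... | no ≰T  = ⊥-elim (absurd (card middle-finite * 2) few (sessions≤crossings P T T< fast))
    where
    T< = ℕₚ.≰⇒> ≰T
    absurd : ∀ f → f * 3 ^ h ≤ card session-finite → card session-finite ≤ T * f → ⊥
    -- With no middle edges the strict inequality `T < 3 ^ h` is lost on multiplication; then no
    -- packet can cross, against the existence of a session.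
    absurd zero    _   le = ℕₚ.n≮0 (ℕₚ.≤-trans some (subst (card session-finite ≤_) (ℕₚ.*-zeroʳ T) le))
    absurd (suc f) few le = ℕₚ.<⇒≱ T< (ℕₚ.*-cancelˡ-≤ (suc f) (ℕₚ.≤-trans few (subst (card session-finite ≤_) (ℕₚ.*-comm T (suc f)) le)))

-- Coding

Bit : Set
Bit = Fin 2

_⊕_ : Bit → Bit → Bit
zero     ⊕ b        = b
suc zero ⊕ zero     = suc zero
suc zero ⊕ suc zero = zero

⊕-cancelˡ : ∀ a {b c} → a ⊕ b ≡ a ⊕ c → b ≡ c
⊕-cancelˡ zero                                eq = eq
⊕-cancelˡ (suc zero) {zero}     {zero}        eq = refl
⊕-cancelˡ (suc zero) {suc zero} {suc zero}    eq = refl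
⊕-cancelˡ (suc zero) {zero}     {suc zero}    ()
⊕-cancelˡ (suc zero) {suc zero} {zero}        ()

⊕-cancelʳ : ∀ a {b c} → b ⊕ a ≡ c ⊕ a → b ≡ c
⊕-cancelʳ a          {zero}     {zero}        eq = refl
⊕-cancelʳ a          {suc zero} {suc zero}    eq = refl
⊕-cancelʳ zero       {zero}     {suc zero}    ()
⊕-cancelʳ (suc zero) {zero}     {suc zero}    ()
⊕-cancelʳ zero       {suc zero} {zero}        ()
⊕-cancelʳ (suc zero) {suc zero} {zero}        ()

parity : ∀ {k} → (Fin k → Bit) → Bit
parity {zero}  f = zero
parity {suc k} f = f zero ⊕ parity (f ∘ suc)

parity-cong : ∀ {k} {f g : Fin k → Bit} → (∀ i → f i ≡ g i) → parity f ≡ parity g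
parity-cong {zero}  eq = refl
parity-cong {suc k} eq = cong₂ _⊕_ (eq zero) (parity-cong (eq ∘ suc))

parity-cancel : ∀ {k} (f g : Fin k → Bit) i → parity f ≡ parity g → (∀ l → l ≢ i → f l ≡ g l) → f i ≡ g i
parity-cancel f g zero    eq others = ⊕-cancelʳ (parity (f ∘ suc))
  (trans eq (cong (g zero ⊕_) (sym (parity-cong (λ l → others (suc l) λ ())))))
parity-cancel f g (suc i) eq others = parity-cancel (f ∘ suc) (g ∘ suc) i
  (⊕-cancelˡ (f zero) (trans eq (cong (_⊕ parity (g ∘ suc)) (sym (others zero λ ())))))
  (λ l l≢i → others (suc l) (l≢i ∘ Finₚ.suc-injective))

-- Rounds from the sources to the sinks of a level j bottle; a slot adds one round for the link at each of its ends.
delay : ℕ → ℕ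
delay zero    = 1
delay (suc j) = delay j + 5 + delay j

module Coding (h : ℕ) (κ : ℕ → ℕ) (I : FreeInvolutions (Bottles.Joint h κ) (3 ^ h)) where
  open Bottles h κ
  open FreeInvolutions I
  open Network h κ I

  In : Set
  In = Input M Bit

  slotValue : ∀ {k} → Slot k → (Fin k → Bit) → Bit
  slotValue (side i j) f = f i
  slotValue (out i)    f = parity f

  -- The bit that session `i` of a bottle must deliver: for a lower bottle, whatever the coding
  -- scheme of the upper bottle sends along the slot that this session replaces.
  packet : ∀ {j} → Context j → Positions j → X → In → Fin (κ j) → Bit
  packet top      is x inp i = Vec.head (inp (enc session-finite (i , is , x)))
  packet (es ▹ e) is x inp i = slotValue e (packet es (i , is) (act (_ , es , e , i , is) x) inp)

  -- The rounds from which the sources of a bottle hold their packets and the source end of a slot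
  -- holds its value. Crossing a slot takes `delay j + 2` rounds with its links, and one more brings
  -- the parity from `u` to `v`.
  known : ∀ {j} → Context j → ℕ
  start : ∀ {j} → Context (suc j) → Slot (κ (suc j)) → ℕ
  known top      = 0
  known (es ▹ e) = suc (start es e)
  start         es (side _ _) = known es
  start {j = j} es (out _)    = known es + (delay j + 3)

  Signal : Set
  Signal = ℕ × (In → Bit)

  jointValue : Joint → X → In → Bit
  jointValue (j , es , e , i , is) x inp = slotValue e (packet es (i , is) x inp)

  -- Every edge is used in one direction, in one round and for one bit, so unit capacities suffice:
  -- source links carry downwards, target links upwards.
  signal : Edge → Bool → Maybe Signal
  signal (inj₁ (wire es x i))                                 true  = just (known es , λ inp → packet es tt x inp i)
  signal (inj₁ (mid (j , es , is , x)))                       true  = just (known es + (delay j + 2) , λ inp → parity (packet es is x inp))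
  signal (inj₁ (link a@(j , es , e , _) x true))              true  = just (start es e , jointValue a x)
  signal (inj₁ (link a@(j , es , e , _) x false))             false = just (suc (start es e) + delay j , jointValue a x)
  signal _                                                    _     = nothing

  emit : ℕ → Maybe Signal → In → Bit
  emit r nothing        inp = zero
  emit r (just (τ , f)) inp with r ℕₚ.≟ τ
  ... | yes _ = f inp
  ... | no  _ = zero

  emit-at : ∀ τ f inp → emit τ (just (τ , f)) inp ≡ f inp
  emit-at τ f inp with τ ℕₚ.≟ τ
  ... | yes _   = refl
  ... | no τ≢τ = ⊥-elim (τ≢τ refl)

  message : MsgFun M Bit
  message r e dir inp = emit r (signal (decᵉ e) dir) inp ∷ []

  View : Vertex → ℕ → In → In → Set
  View w = SameView M message (encᵛ w)

  view-message : ∀ {w r τ x y} → View w r x y → τ < r → ∀ e dir → receiver M e dir ≡ encᵛ w →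
                 message τ e dir x ≡ message τ e dir y
  view-message {r = suc r} {τ} (before , now) τ<r e dir rcv with τ ℕₚ.≟ r
  ... | yes refl = now e dir rcv
  ... | no τ≢r   = view-message before (ℕₚ.≤∧≢⇒< (ℕₚ.≤-pred τ<r) τ≢r) e dir rcv

  heard : ∀ {w r x y} → View w r x y → ∀ e dir {τ f} → signal e dir ≡ just (τ , f) → head e dir ≡ w → τ < r → f x ≡ f y
  heard {x = x} {y} view e dir {τ} {f} sig hd τ<r = begin
    f x                                              ≡⟨ emit-at τ f x ⟨
    emit τ (just (τ , f)) x                          ≡⟨ cong (λ z → emit τ z x) sig′ ⟨
    emit τ (signal (decᵉ (encᵉ e)) dir) x            ≡⟨ cong Vec.head (view-message view τ<r (encᵉ e) dir rcv) ⟩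
    emit τ (signal (decᵉ (encᵉ e)) dir) y            ≡⟨ cong (λ z → emit τ z y) sig′ ⟩
    emit τ (just (τ , f)) y                          ≡⟨ emit-at τ f y ⟩
    f y                                              ∎
    where
    open ≡-Reasoning
    sig′ : signal (decᵉ (encᵉ e)) dir ≡ just (τ , f)
    sig′ = trans (cong (λ e → signal e dir) (Finite.dec∘enc edge-finite e)) sig
    rcv = trans (receiver-head (encᵉ e) dir) (cong encᵛ (trans (cong (λ e → head e dir) (Finite.dec∘enc edge-finite e)) hd))

  view-initial : ∀ {w r x y} → View w r x y → View w 0 x y
  view-initial {r = zero}  view         = view
  view-initial {r = suc r} (before , _) = view-initial before

  at-source : ∀ {j} (es : Context j) is x i {r inp inp′} → known es ≤ r →
              View (core (j , es , is , x , s i)) r inp inp′ → packet es is x inp i ≡ packet es is x inp′ i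
  at-source top      is x i le view =
    cong Vec.head (view-initial view (enc session-finite (i , is , x)) (cong (encᵛ ∘ source) (Finite.dec∘enc session-finite _)))
  at-source (es ▹ e) is x i le view =
    heard view (inj₁ (link a (act a x) true)) true refl
      (cong (λ x → core (_ , es ▹ e , is , x , s i)) (involutive a x)) le
    where a = _ , es , e , i , is

  -- The end `p` is an argument of its own because `slotTgt` of a side slot reduces only after its
  -- indices are compared.
  above : ∀ {j} (es : Context (suc j)) e i is x {r inp inp′ p} → slotTgt e ≡ p → start es e + (delay j + 2) ≤ r →
          View (core (suc j , es , (i , is) , x , p)) r inp inp′ →
          slotValue e (packet es (i , is) x inp) ≡ slotValue e (packet es (i , is) x inp′)
  above {j} es e i is x refl le view =
    heard view (inj₁ (link (j , es , e , i , is) x false)) false refl refl (ℕₚ.≤-trans (ℕₚ.≤-reflexive rearrange) le)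
    where
    eq : ∀ a d → suc (suc a + d) ≡ a + (d + 2)
    eq = ℕ-solve-∀
    rearrange = eq (start es e) (delay j)

  side-to-u : ∀ {k} (l : Fin k) → slotTgt (side l l) ≡ u
  side-to-u l with l Finₚ.≟ l
  ... | yes _   = refl
  ... | no l≢l = ⊥-elim (l≢l refl)

  side-to-t : ∀ {k} (l i : Fin k) → l ≢ i → slotTgt (side l i) ≡ t i
  side-to-t l i l≢i with l Finₚ.≟ i
  ... | yes l≡i = ⊥-elim (l≢i l≡i)
  ... | no _    = refl

  at-u : ∀ {j} (es : Context (suc j)) is x {r inp inp′} → known es + (delay j + 2) ≤ r →
         View (core (suc j , es , is , x , u)) r inp inp′ → parity (packet es is x inp) ≡ parity (packet es is x inp′)
  at-u es (i , is) x le view = parity-cong λ l → above es (side l l) i is x (side-to-u l) le view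

  at-v : ∀ {j} (es : Context (suc j)) is x {r inp inp′} → known es + (delay j + 3) ≤ r →
         View (core (suc j , es , is , x , v)) r inp inp′ → parity (packet es is x inp) ≡ parity (packet es is x inp′)
  at-v {j} es is x le view = heard view (inj₁ (mid (j , es , is , x))) true refl refl (ℕₚ.≤-trans (ℕₚ.≤-reflexive (eq (known es) (delay j))) le)
    where
    eq : ∀ a d → suc (a + (d + 2)) ≡ a + (d + 3)
    eq = ℕ-solve-∀

  at-sink : ∀ {j} (es : Context j) is x i {r inp inp′} → known es + delay j ≤ r →
            View (core (j , es , is , x , t i)) r inp inp′ → packet es is x inp i ≡ packet es is x inp′ i
  at-sink {zero}  es tt x i {r} le view = heard view (inj₁ (wire es x i)) true refl refl (subst (_≤ r) (ℕₚ.+-comm (known es) 1) le)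
  at-sink {suc j} es (i′ , is) x i {r} le view = parity-cancel _ _ i
    (above es (out i) i′ is x refl (ℕₚ.≤-trans (ℕₚ.≤-reflexive (eq (known es) (delay j))) le) view)
    (λ l l≢i → above es (side l i) i′ is x (side-to-t l i l≢i)
      (ℕₚ.≤-trans (ℕₚ.+-monoʳ-≤ (known es) (ℕₚ.≤-trans (ℕₚ.+-monoʳ-≤ (delay j) {2} {5} (s≤s (s≤s z≤n))) (ℕₚ.m≤m+n _ _))) le) view)
    where
    eq : ∀ a d → a + (d + 3) + (d + 2) ≡ a + (d + 5 + d)
    eq = ℕ-solve-∀

  at-slot-source : ∀ {j} (es : Context (suc j)) is x e {r inp inp′} → start es e ≤ r →
                   View (core (suc j , es , is , x , slotSrc e)) r inp inp′ →
                   slotValue e (packet es is x inp) ≡ slotValue e (packet es is x inp′)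
  at-slot-source es is x (side i l) = at-source es is x i
  at-slot-source es is x (out i)    = at-v es is x

  causal : ∀ e dir {τ f x y} → signal e dir ≡ just (τ , f) → View (tail e dir) τ x y → f x ≡ f y
  causal (inj₁ (wire es x i))               true  refl = at-source es tt x i ℕₚ.≤-refl
  causal (inj₁ (mid (j , es , is , x)))     true  refl = at-u es is x ℕₚ.≤-refl
  causal (inj₁ (link (j , es , e , i , is) x true))  true  refl = at-slot-source es (i , is) x e ℕₚ.≤-refl
  causal (inj₁ (link a@(j , es , e , i , is) x false)) false {x = inp} {inp′} refl view =
    subst (λ z → slotValue e (packet es (i , is) z inp) ≡ slotValue e (packet es (i , is) z inp′)) (involutive a x)
      (at-sink (es ▹ e) is (act a x) i ℕₚ.≤-refl view)
  causal (inj₁ (wire _ _ _))    false ()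
  causal (inj₁ (mid _))         false ()
  causal (inj₁ (link _ _ true))  false ()
  causal (inj₁ (link _ _ false)) true  ()
  causal (inj₂ _)               _     ()

  emit-causal : ∀ r e dir {x y} → View (tail e dir) r x y → emit r (signal e dir) x ≡ emit r (signal e dir) y
  emit-causal r e dir view = go (signal e dir) refl
    where
    go : ∀ sig → signal e dir ≡ sig → emit r sig _ ≡ emit r sig _
    go nothing        _   = refl
    go (just (τ , f)) eq with r ℕₚ.≟ τ
    ... | yes refl = causal e dir eq view
    ... | no _     = refl

  protocol : CodingProtocol M Bit
  protocol = record
    { msg    = message
    ; causal = λ r e dir x y view → cong (_∷ []) (emit-causal r (decᵉ e) dir
        (subst (λ w → SameView M message w r x y) (sender-tail e dir) view))
    }

  coding-makespan : CodingAchieves M (delay h)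
  coding-makespan = 2 , s≤s (s≤s z≤n) , protocol , decode
    where
    singleton : ∀ {A : Set} (a b : Vec A 1) → Vec.head a ≡ Vec.head b → a ≡ b
    singleton (a ∷ []) (.a ∷ []) refl = refl
    decode : CodingMakespan≤ M protocol (delay h)
    decode σ x y view = singleton (x σ) (y σ)
      (subst (λ z → Vec.head (x z) ≡ Vec.head (y z)) (Finite.enc∘dec session-finite σ)
        (at-sink top _ _ _ ℕₚ.≤-refl view))

-- Counting

-- Every level has Y times as many positions as the product of (1 + positions) over the higher levels,
-- which makes the number of sessions exactly Y times the number of bottles of each level.
module Widths (Y : ℕ) where
  spread : ℕ → ℕ
  width  : ℕ → ℕ
  spread zero    = 1
  spread (suc d) = spread d * suc (width d)
  width d = Y * spread d

  volume : ℕ → ℕ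
  volume zero    = 1
  volume (suc d) = volume d * width d

  volume≤spread : ∀ d → volume d ≤ spread d
  volume≤spread zero    = ℕₚ.≤-refl
  volume≤spread (suc d) = ℕₚ.*-mono-≤ (volume≤spread d) (ℕₚ.n≤1+n _)

  spread-mono : ∀ {d d′} → d ≤ d′ → spread d ≤ spread d′
  spread-mono {d} d≤d′ = go (ℕₚ.≤⇒≤′ d≤d′)
    where
    go : ∀ {d′} → d ≤′ d′ → spread d ≤ spread d′
    go ≤′-refl     = ℕₚ.≤-refl
    go (≤′-step l) = ℕₚ.≤-trans (go l) (ℕₚ.m≤m*n _ _)

  -- The factor `2 * Y` turns the recursion into squaring, since `suc (width d)` is at most
  -- `2 * Y * spread d`.
  spread-bound : 1 ≤ Y → ∀ d → 2 * Y * spread d ≤ (2 * Y) ^ (2 ^ d)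
  spread-bound 1≤Y zero    = ℕₚ.≤-refl
  spread-bound 1≤Y (suc d) = begin
    2 * Y * (spread d * suc (width d))             ≡⟨ ℕₚ.*-assoc (2 * Y) (spread d) _ ⟨
    2 * Y * spread d * suc (width d)               ≤⟨ ℕₚ.*-monoʳ-≤ (2 * Y * spread d) (ℕₚ.+-monoˡ-≤ (width d) 1≤width) ⟩
    2 * Y * spread d * (width d + width d)         ≡⟨ cong (2 * Y * spread d *_) (double Y (spread d)) ⟩
    2 * Y * spread d * (2 * Y * spread d)          ≤⟨ ℕₚ.*-mono-≤ (spread-bound 1≤Y d) (spread-bound 1≤Y d) ⟩
    (2 * Y) ^ (2 ^ d) * (2 * Y) ^ (2 ^ d)          ≡⟨ ℕₚ.^-distribˡ-+-* (2 * Y) (2 ^ d) (2 ^ d) ⟨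
    (2 * Y) ^ (2 ^ d + 2 ^ d)                      ≡⟨ cong (λ n → (2 * Y) ^ (2 ^ d + n)) (ℕₚ.+-identityʳ (2 ^ d)) ⟨
    (2 * Y) ^ (2 ^ suc d)                          ∎
    where
    open ℕₚ.≤-Reasoning
    1≤width : 1 ≤ width d
    1≤width = ℕₚ.*-mono-≤ 1≤Y (spread-mono (z≤n {d}))
    double : ∀ y p → y * p + y * p ≡ 2 * y * p
    double = ℕ-solve-∀

module Counting (h Y : ℕ) where
  open Widths Y

  κ : ℕ → ℕ
  κ j = width (h ∸ j)

  open Bottles h κ
  open Finiteness h κ

  κ-at : ∀ d j → d + j ≡ h → κ j ≡ width d
  κ-at d j refl = cong width (ℕₚ.m+n∸n≡m d j)

  contexts positions : ℕ → ℕ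
  contexts j  = card (context-finite j)
  positions j = card (positions-finite j)

  shift : ∀ {d j} → suc d + j ≡ h → d + suc j ≡ h
  shift {d} {j} eq = trans (ℕₚ.+-suc d j) eq

  contexts-below : ∀ j → j < h → contexts j ≡ contexts (suc j) * card (Slot-finite (κ (suc j)))
  contexts-below j j<h = card-unique (context-▹ j<h) (context-finite j) (context-finite (suc j) ×-finite Slot-finite (κ (suc j)))

  -- A bottle with w sessions has w² + w = w (1 + w) slots; the factors w collect in `volume` and
  -- the factors 1 + w in `spread`.
  contexts-count : ∀ d j → d + j ≡ h → contexts j ≡ volume d * spread d
  contexts-count zero    j refl = card-unique context-top (context-finite h) ⊤-finite
  contexts-count (suc d) j eq   = begin
    contexts j                                                ≡⟨ contexts-below j (subst (suc j ≤_) eq (s≤s (ℕₚ.m≤n+m j d))) ⟩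
    contexts (suc j) * (κ (suc j) * κ (suc j) + κ (suc j))    ≡⟨ cong₂ (λ c k → c * (k * k + k)) (contexts-count d (suc j) (shift eq)) (κ-at d (suc j) (shift eq)) ⟩
    volume d * spread d * (width d * width d + width d)       ≡⟨ regroup (volume d) (spread d) (width d) ⟩
    volume d * width d * (spread d * suc (width d))           ∎
    where
    open ≡-Reasoning
    regroup : ∀ a p w → a * p * (w * w + w) ≡ a * w * (p * suc w)
    regroup = ℕ-solve-∀

  total : ℕ
  total = positions (suc h)

  -- Both sides are the product of all widths: `volume d` supplies those of the levels above `j`.
  positions-count : ∀ d j → d + j ≡ h → positions (suc j) * volume d ≡ total
  positions-count zero    j refl = ℕₚ.*-identityʳ total
  positions-count (suc d) j eq   = begin
    positions (suc j) * (volume d * width d)      ≡⟨ cong (λ k → positions (suc j) * (volume d * k)) (κ-at d (suc j) (shift eq)) ⟨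
    positions (suc j) * (volume d * κ (suc j))    ≡⟨ regroup (positions (suc j)) (volume d) (κ (suc j)) ⟩
    κ (suc j) * positions (suc j) * volume d      ≡⟨ positions-count d (suc j) (shift eq) ⟩
    total                                         ∎
    where
    open ≡-Reasoning
    regroup : ∀ p a k → p * (a * k) ≡ k * p * a
    regroup = ℕ-solve-∀

  total≤ : total ≤ spread (suc h)
  total≤ = begin
    total                     ≡⟨ positions-count h 0 (ℕₚ.+-identityʳ h) ⟨
    κ 0 * 1 * volume h        ≡⟨ cong (_* volume h) (ℕₚ.*-identityʳ (κ 0)) ⟩
    width h * volume h        ≡⟨ ℕₚ.*-comm (width h) (volume h) ⟩
    volume (suc h)            ≤⟨ volume≤spread (suc h) ⟩
    spread (suc h)            ∎
    where open ℕₚ.≤-Reasoning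

  -- The factor `spread d` in the number of contexts joins with `Y` to the width of level `j`, just
  -- the factor missing from `positions (suc j)`. This is what the recursion for `width` is designed
  -- for.
  bottle-count : ∀ d j → d + j ≡ h → Y * (contexts j * positions j) ≡ total
  bottle-count d j eq = begin
    Y * (contexts j * positions j)                 ≡⟨ cong (λ c → Y * (c * positions j)) (contexts-count d j eq) ⟩
    Y * (volume d * spread d * positions j)        ≡⟨ regroup Y (volume d) (spread d) (positions j) ⟩
    width d * positions j * volume d               ≡⟨ cong (λ k → k * positions j * volume d) (κ-at d j eq) ⟨
    positions (suc j) * volume d                   ≡⟨ positions-count d j eq ⟩
    total                                          ∎
    where
    open ≡-Reasoning
    regroup : ∀ y a p q → y * (a * p * q) ≡ y * p * q * a
    regroup = ℕ-solve-∀

  middles-bound : ∀ c → Y * sumBelow h (λ j → contexts (suc j) * (positions (suc j) * c)) ≤ h * (total * c)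
  middles-bound c = sumBelow-bound h Y (total * c) _ λ j j<h → ℕₚ.≤-reflexive (begin
    Y * (contexts (suc j) * (positions (suc j) * c))     ≡⟨ regroup Y (contexts (suc j)) (positions (suc j)) c ⟩
    Y * (contexts (suc j) * positions (suc j)) * c       ≡⟨ cong (_* c) (bottle-count (h ∸ suc j) (suc j) (ℕₚ.m∸n+n≡m j<h)) ⟩
    total * c                                            ∎)
    where
    open ≡-Reasoning
    regroup : ∀ y a p c → y * (a * (p * c)) ≡ y * (a * p) * c
    regroup = ℕ-solve-∀

  joints-bound : card joint-finite ≤ h * (spread (suc h) * spread (suc h))
  joints-bound = subst (_≤ h * (spread (suc h) * spread (suc h))) (trans (ℕₚ.*-identityˡ _) (sym card-joint))
    (sumBelow-bound h 1 _ _ bound-at)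
    where
    open ℕₚ.≤-Reasoning
    regroup : ∀ c m k p → 1 * (c * (m * (k * p))) ≡ c * m * (k * p)
    regroup = ℕ-solve-∀
    regroup′ : ∀ a p q → a * p * q ≡ p * (q * a)
    regroup′ = ℕ-solve-∀
    bound-at : ∀ j → j < h → 1 * (contexts (suc j) * (card (Slot-finite (κ (suc j))) * (κ j * positions j))) ≤ spread (suc h) * spread (suc h)
    bound-at j j<h = begin
      1 * (contexts (suc j) * (card (Slot-finite (κ (suc j))) * (κ j * positions j)))   ≡⟨ regroup (contexts (suc j)) (card (Slot-finite (κ (suc j)))) (κ j) (positions j) ⟩
      contexts (suc j) * card (Slot-finite (κ (suc j))) * positions (suc j)             ≡⟨ cong (_* positions (suc j)) (contexts-below j j<h) ⟨
      contexts j * positions (suc j)                                                    ≡⟨ cong (_* positions (suc j)) (contexts-count d j d+j≡h) ⟩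
      volume d * spread d * positions (suc j)                                           ≡⟨ regroup′ (volume d) (spread d) (positions (suc j)) ⟩
      spread d * (positions (suc j) * volume d)                                         ≡⟨ cong (spread d *_) (positions-count d j d+j≡h) ⟩
      spread d * total                                                                  ≤⟨ ℕₚ.*-mono-≤ (spread-mono (ℕₚ.m≤n⇒m≤1+n (ℕₚ.m∸n≤m h j))) total≤ ⟩
      spread (suc h) * spread (suc h)                                                   ∎
      where
      d = h ∸ j
      d+j≡h = ℕₚ.m∸n+n≡m (ℕₚ.<⇒≤ j<h)

  positions-positive : 1 ≤ Y → ∀ j → 1 ≤ positions j
  positions-positive 1≤Y zero    = ℕₚ.≤-refl
  positions-positive 1≤Y (suc j) =
    ℕₚ.*-mono-≤ (ℕₚ.*-mono-≤ 1≤Y (spread-mono (z≤n {h ∸ j}))) (positions-positive 1≤Y j)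

  total≥Y : 1 ≤ Y → Y ≤ total
  total≥Y 1≤Y = begin
    Y                          ≡⟨ ℕₚ.*-identityʳ Y ⟨
    Y * 1                      ≤⟨ ℕₚ.*-monoʳ-≤ Y (ℕₚ.*-mono-≤ (spread-mono (z≤n {h ∸ h})) (positions-positive 1≤Y h)) ⟩
    Y * (spread (h ∸ h) * positions h)   ≡⟨ ℕₚ.*-assoc Y (spread (h ∸ h)) (positions h) ⟨
    total                      ∎
    where open ℕₚ.≤-Reasoning

-- Numerical estimates

bound≤2^ : ∀ A c → Bounds.base A ≤ 2 ^ c → ∀ n → Bounds.bound A n ≤ 2 ^ (n * (c + c))
bound≤2^ A c le zero    = ℕₚ.≤-refl
bound≤2^ A c le (suc n) = begin
  base * (base * bound n)                 ≤⟨ ℕₚ.*-mono-≤ le (ℕₚ.*-mono-≤ le (bound≤2^ A c le n)) ⟩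
  2 ^ c * (2 ^ c * 2 ^ (n * (c + c)))     ≡⟨ cong (2 ^ c *_) (ℕₚ.^-distribˡ-+-* 2 c (n * (c + c))) ⟨
  2 ^ c * 2 ^ (c + n * (c + c))           ≡⟨ ℕₚ.^-distribˡ-+-* 2 c (c + n * (c + c)) ⟨
  2 ^ (c + (c + n * (c + c)))             ≡⟨ cong (2 ^_) (ℕₚ.+-assoc c c (n * (c + c))) ⟨
  2 ^ (suc n * (c + c))                   ∎
  where
  open ℕₚ.≤-Reasoning
  open Bounds A

n≤2^n : ∀ n → n ≤ 2 ^ n
n≤2^n zero    = z≤n
n≤2^n (suc n) = ℕₚ.+-mono-≤ (ℕₚ.m^n>0 2 n) (subst (n ≤_) (sym (ℕₚ.+-identityʳ (2 ^ n))) (n≤2^n n))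

suc≤2^suc : ∀ {a c} → a ≤ 2 ^ c → suc a ≤ 2 ^ suc c
suc≤2^suc {a} {c} le = ℕₚ.+-mono-≤ (ℕₚ.m^n>0 2 c) (subst (a ≤_) (sym (ℕₚ.+-identityʳ (2 ^ c))) le)

delay-closed : ∀ h → delay h + 5 ≡ 6 * 2 ^ h
delay-closed zero    = refl
delay-closed (suc h) = trans (regroup (delay h)) (trans (cong (2 *_) (delay-closed h)) (regroup′ (2 ^ h)))
  where
  regroup : ∀ d → d + 5 + d + 5 ≡ 2 * (d + 5)
  regroup = ℕ-solve-∀
  regroup′ : ∀ p → 2 * (6 * p) ≡ 6 * (2 * p)
  regroup′ = ℕ-solve-∀

delay≥1 : ∀ h → 1 ≤ delay h
delay≥1 zero    = ℕₚ.≤-refl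
delay≥1 (suc h) = ℕₚ.≤-trans (delay≥1 h) (ℕₚ.≤-trans (ℕₚ.m≤m+n (delay h) 5) (ℕₚ.m≤m+n _ _))

^-distribʳ-* : ∀ n a b → (a * b) ^ n ≡ a ^ n * b ^ n
^-distribʳ-* zero    a b = refl
^-distribʳ-* (suc n) a b = trans (cong (a * b *_) (^-distribʳ-* n a b)) (regroup a b (a ^ n) (b ^ n))
  where
  regroup : ∀ a b p q → a * b * (p * q) ≡ a * p * (b * q)
  regroup = ℕ-solve-∀

^-comm : ∀ a m n → (a ^ m) ^ n ≡ (a ^ n) ^ m
^-comm a m n = trans (ℕₚ.^-*-assoc a m n) (trans (cong (a ^_) (ℕₚ.*-comm m n)) (sym (ℕₚ.^-*-assoc a n m)))

-- Taking powers avoids roots: when `C` is at most the `suc q`-th power of 3/2, the `suc q`-th power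
-- of the gap outgrows the logarithm. Enlarging `B` to its power lets `A * B` serve as the constant.
gap-bound : ∀ q A B C h TC lg TR → 1 ≤ B → 2 ^ suc q * C ≤ 3 ^ suc q →
            TC ≤ A * 2 ^ h → lg ≤ B * C ^ h → 3 ^ h ≤ TR →
            (1 ^ suc q) * (TC ^ suc q) * (lg ^ 1) ≤ (A * B * TR) ^ suc q
gap-bound q′ A B C h TC lg TR 1≤B 2C≤3 TC≤ lg≤ ≤TR = begin
  (1 ^ q) * (TC ^ q) * (lg ^ 1)           ≡⟨ cong₂ _*_ (trans (cong (_* TC ^ q) (ℕₚ.^-zeroˡ q)) (ℕₚ.*-identityˡ (TC ^ q))) (ℕₚ.*-identityʳ lg) ⟩
  TC ^ q * lg                             ≤⟨ ℕₚ.*-mono-≤ (ℕₚ.^-monoˡ-≤ q TC≤) lg≤ ⟩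
  (A * 2 ^ h) ^ q * (B * C ^ h)           ≡⟨ cong (_* (B * C ^ h)) (trans (^-distribʳ-* q A (2 ^ h)) (cong (A ^ q *_) (^-comm 2 h q))) ⟩
  A ^ q * (2 ^ q) ^ h * (B * C ^ h)       ≡⟨ interchange (A ^ q) ((2 ^ q) ^ h) B (C ^ h) ⟩
  A ^ q * B * ((2 ^ q) ^ h * C ^ h)       ≡⟨ cong (A ^ q * B *_) (^-distribʳ-* h (2 ^ q) C) ⟨
  A ^ q * B * (2 ^ q * C) ^ h             ≤⟨ ℕₚ.*-mono-≤ (ℕₚ.*-monoʳ-≤ (A ^ q) B≤B^q) (ℕₚ.^-monoˡ-≤ h 2C≤3) ⟩
  A ^ q * B ^ q * (3 ^ q) ^ h             ≡⟨ cong₂ _*_ (^-distribʳ-* q A B) (^-comm 3 h q) ⟨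
  (A * B) ^ q * (3 ^ h) ^ q               ≤⟨ ℕₚ.*-monoʳ-≤ ((A * B) ^ q) (ℕₚ.^-monoˡ-≤ q ≤TR) ⟩
  (A * B) ^ q * TR ^ q                    ≡⟨ ^-distribʳ-* q (A * B) TR ⟨
  (A * B * TR) ^ q                        ∎
  where
  open ℕₚ.≤-Reasoning
  q : ℕ
  q = suc q′
  interchange : ∀ a b c d → a * b * (c * d) ≡ a * c * (b * d)
  interchange = ℕ-solve-∀
  B≤B^q : B ≤ B ^ q
  B≤B^q = ℕₚ.m≤m*n B (B ^ q′) {{ℕₚ.m^n≢0 B q′ {{>-nonZero 1≤B}}}}

module Family (h : ℕ) where
  -- Must be at least `2 * 3 ^ h * h`, for two directions, `3 ^ h` rounds and `h` levels with middle
  -- edges. Replacing 3 by 4 and `h` by `2 ^ h` gives this power of two.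
  Y : ℕ
  Y = 2 ^ (3 * h + 1)

  1≤Y : 1 ≤ Y
  1≤Y = ℕₚ.m^n>0 2 (3 * h + 1)

  open Widths Y
  open Counting h Y
  open Bottles h κ
  open Finiteness h κ

  letters : ℕ
  letters = card joint-finite

  I : FreeInvolutions Joint (3 ^ h)
  I = matrixInvolutions letters (3 ^ h) (enc joint-finite) (Finite.enc-injective joint-finite)

  open FreeInvolutions I using (X-finite; basepoint)
  open Network h κ I using (M; session-finite; middle-finite; card-session; card-middle)

  fibres : ℕ
  fibres = card X-finite

  sessions≡ : card session-finite ≡ total * fibres
  sessions≡ = trans card-session (sym (ℕₚ.*-assoc (κ h) (positions h) fibres))

  fibres≥1 : 1 ≤ fibres
  fibres≥1 = ℕₚ.≤-trans (s≤s z≤n) (Finₚ.toℕ<n (enc X-finite basepoint))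

  Y≤sessions : Y ≤ card session-finite
  Y≤sessions = subst (Y ≤_) (sym sessions≡)
    (subst (_≤ total * fibres) (ℕₚ.*-identityʳ Y) (ℕₚ.*-mono-≤ (total≥Y 1≤Y) fibres≥1))

  h≤Y : h ≤ Y
  h≤Y = ℕₚ.≤-trans (n≤2^n h) (ℕₚ.^-monoʳ-≤ 2 (ℕₚ.≤-trans (ℕₚ.m≤n*m h 3) (ℕₚ.m≤m+n (3 * h) 1)))

  2*3^h*h≤Y : 2 * 3 ^ h * h ≤ Y
  2*3^h*h≤Y = begin
    2 * 3 ^ h * h               ≤⟨ ℕₚ.*-mono-≤ (ℕₚ.*-monoʳ-≤ 2 (ℕₚ.^-monoˡ-≤ h (ℕₚ.n≤1+n 3))) (n≤2^n h) ⟩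
    2 * (2 * 2) ^ h * 2 ^ h     ≡⟨ cong (λ n → 2 * n * 2 ^ h) (^-distribʳ-* h 2 2) ⟩
    2 * (2 ^ h * 2 ^ h) * 2 ^ h ≡⟨ regroup (2 ^ h) ⟩
    2 ^ h * (2 ^ h * 2 ^ h) * 2 ≡⟨ cong (λ n → 2 ^ h * n * 2) (ℕₚ.^-distribˡ-+-* 2 h h) ⟨
    2 ^ h * 2 ^ (h + h) * 2     ≡⟨ cong (_* 2) (ℕₚ.^-distribˡ-+-* 2 h (h + h)) ⟨
    2 ^ (h + (h + h)) * 2       ≡⟨ ℕₚ.^-distribˡ-+-* 2 (h + (h + h)) 1 ⟨
    2 ^ (h + (h + h) + 1)       ≡⟨ cong (λ n → 2 ^ (h + (h + n) + 1)) (ℕₚ.+-identityʳ h) ⟨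
    Y                           ∎
    where
    open ℕₚ.≤-Reasoning
    regroup : ∀ p → 2 * (p * p) * p ≡ p * (p * p) * 2
    regroup = ℕ-solve-∀

  few-middles : h ≢ 0 → card middle-finite * 2 * 3 ^ h ≤ card session-finite
  -- The sum over `h` levels leaves a factor `h` on the side of the sessions, so both sides are
  -- compared after multiplication by `h`.
  few-middles h≢0 = ℕₚ.*-cancelˡ-≤ h {{≢-nonZero h≢0}} (begin
    h * (card middle-finite * 2 * 3 ^ h)     ≡⟨ regroup h (card middle-finite) (3 ^ h) ⟩
    2 * 3 ^ h * h * card middle-finite       ≤⟨ ℕₚ.*-monoˡ-≤ (card middle-finite) 2*3^h*h≤Y ⟩
    Y * card middle-finite                   ≡⟨ cong (Y *_) card-middle ⟩
    Y * sumBelow h _                         ≤⟨ middles-bound fibres ⟩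
    h * (total * fibres)                     ≡⟨ cong (h *_) sessions≡ ⟨
    h * card session-finite                  ∎)
    where
    open ℕₚ.≤-Reasoning
    regroup : ∀ h c p → h * (c * 2 * p) ≡ 2 * p * h * c
    regroup = ℕ-solve-∀

  -- Binary exponents: `σ` bounds `spread (suc h)`, `ω` bounds `Bounds.base letters`, and `ν` below
  -- bounds the modulus.
  σ ω : ℕ
  σ = (3 * h + 2) * 2 ^ suc h
  ω = 2 + (h + (σ + σ))

  spread≤ : spread (suc h) ≤ 2 ^ σ
  spread≤ = begin
    spread (suc h)                    ≤⟨ ℕₚ.m≤n*m (spread (suc h)) (2 * Y) {{ℕₚ.m*n≢0 2 Y {{_}} {{ℕₚ.m^n≢0 2 (3 * h + 1)}}}} ⟩
    2 * Y * spread (suc h)            ≤⟨ spread-bound 1≤Y (suc h) ⟩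
    (2 * Y) ^ (2 ^ suc h)             ≡⟨ ℕₚ.^-*-assoc 2 (suc (3 * h + 1)) (2 ^ suc h) ⟩
    2 ^ (suc (3 * h + 1) * 2 ^ suc h) ≡⟨ cong (λ n → 2 ^ (n * 2 ^ suc h)) (ℕₚ.+-suc (3 * h) 1) ⟨
    2 ^ σ                             ∎
    where open ℕₚ.≤-Reasoning

  base≤ : Bounds.base letters ≤ 2 ^ ω
  base≤ = suc≤2^suc {c = suc (h + (σ + σ))} (ℕₚ.*-monoʳ-≤ 2 (begin
    letters                             ≤⟨ joints-bound ⟩
    h * (spread (suc h) * spread (suc h)) ≤⟨ ℕₚ.*-mono-≤ (n≤2^n h) (ℕₚ.*-mono-≤ spread≤ spread≤) ⟩
    2 ^ h * (2 ^ σ * 2 ^ σ)             ≡⟨ cong (2 ^ h *_) (ℕₚ.^-distribˡ-+-* 2 σ σ) ⟨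
    2 ^ h * 2 ^ (σ + σ)                 ≡⟨ ℕₚ.^-distribˡ-+-* 2 h (σ + σ) ⟨
    2 ^ (h + (σ + σ))                   ∎))
    where open ℕₚ.≤-Reasoning

  ν : ℕ
  ν = suc (3 ^ h * (ω + ω))

  modulus≤ : modulus letters (3 ^ h) ≤ 2 ^ ν
  modulus≤ = suc≤2^suc {c = 3 ^ h * (ω + ω)} (bound≤2^ letters ω base≤ (3 ^ h))

  fibres≤ : fibres ≤ 2 ^ (ν + ν + (ν + ν))
  fibres≤ = begin
    fibres                            ≤⟨ card-Matrices letters (3 ^ h) ⟩
    (N * N) * (N * N)                 ≤⟨ ℕₚ.*-mono-≤ (ℕₚ.*-mono-≤ modulus≤ modulus≤) (ℕₚ.*-mono-≤ modulus≤ modulus≤) ⟩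
    2 ^ ν * 2 ^ ν * (2 ^ ν * 2 ^ ν)   ≡⟨ cong₂ _*_ (ℕₚ.^-distribˡ-+-* 2 ν ν) (ℕₚ.^-distribˡ-+-* 2 ν ν) ⟨
    2 ^ (ν + ν) * 2 ^ (ν + ν)         ≡⟨ ℕₚ.^-distribˡ-+-* 2 (ν + ν) (ν + ν) ⟨
    2 ^ (ν + ν + (ν + ν))             ∎
    where
    open ℕₚ.≤-Reasoning
    N = modulus letters (3 ^ h)

  sessions≤ : card session-finite ≤ 2 ^ (σ + (ν + ν + (ν + ν)))
  sessions≤ = begin
    card session-finite                  ≡⟨ sessions≡ ⟩
    total * fibres                       ≤⟨ ℕₚ.*-mono-≤ (ℕₚ.≤-trans total≤ spread≤) fibres≤ ⟩
    2 ^ σ * 2 ^ (ν + ν + (ν + ν))        ≡⟨ ℕₚ.^-distribˡ-+-* 2 σ (ν + ν + (ν + ν)) ⟨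
    2 ^ (σ + (ν + ν + (ν + ν)))          ∎
    where open ℕₚ.≤-Reasoning

  σ≤ : σ ≤ 10 * 4 ^ h
  σ≤ = begin
    (3 * h + 2) * 2 ^ suc h                 ≤⟨ ℕₚ.*-monoˡ-≤ (2 ^ suc h) (ℕₚ.+-mono-≤ (ℕₚ.*-monoʳ-≤ 3 (n≤2^n h)) (ℕₚ.*-monoʳ-≤ 2 (ℕₚ.m^n>0 2 h))) ⟩
    (3 * 2 ^ h + 2 * 2 ^ h) * (2 * 2 ^ h)   ≡⟨ regroup (2 ^ h) ⟩
    10 * (2 ^ h * 2 ^ h)                    ≡⟨ cong (10 *_) (^-distribʳ-* h 2 2) ⟨
    10 * 4 ^ h                              ∎
    where
    open ℕₚ.≤-Reasoning
    regroup : ∀ p → (3 * p + 2 * p) * (2 * p) ≡ 10 * (p * p)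
    regroup = ℕ-solve-∀

  ω≤ : ω ≤ 23 * 4 ^ h
  ω≤ = begin
    2 + (h + (σ + σ))                                        ≤⟨ ℕₚ.+-mono-≤ (ℕₚ.*-monoʳ-≤ 2 (ℕₚ.m^n>0 4 h))
                                                                 (ℕₚ.+-mono-≤ (ℕₚ.≤-trans (n≤2^n h) (ℕₚ.^-monoˡ-≤ h (s≤s (s≤s z≤n)))) (ℕₚ.+-mono-≤ σ≤ σ≤)) ⟩
    2 * 4 ^ h + (4 ^ h + (10 * 4 ^ h + 10 * 4 ^ h))          ≡⟨ regroup (4 ^ h) ⟩
    23 * 4 ^ h                                               ∎
    where
    open ℕₚ.≤-Reasoning
    regroup : ∀ p → 2 * p + (p + (10 * p + 10 * p)) ≡ 23 * p
    regroup = ℕ-solve-∀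

  -- The 12 is 3 · 4: words have length up to `3 ^ h`, and each letter costs a number of binary
  -- digits of order `4 ^ h`, where a factor `h` has been absorbed as `2 ^ h`.
  ν≤ : ν ≤ 47 * 12 ^ h
  ν≤ = begin
    1 + 3 ^ h * (ω + ω)                                ≤⟨ ℕₚ.+-mono-≤ (ℕₚ.m^n>0 12 h) (ℕₚ.*-monoʳ-≤ (3 ^ h) (ℕₚ.+-mono-≤ ω≤ ω≤)) ⟩
    12 ^ h + 3 ^ h * (23 * 4 ^ h + 23 * 4 ^ h)         ≡⟨ cong (12 ^ h +_) (regroup (3 ^ h) (4 ^ h)) ⟩
    12 ^ h + 46 * (3 ^ h * 4 ^ h)                      ≡⟨ cong (λ n → 12 ^ h + 46 * n) (^-distribʳ-* h 3 4) ⟨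
    47 * 12 ^ h                                        ∎
    where
    open ℕₚ.≤-Reasoning
    regroup : ∀ p q → p * (23 * q + 23 * q) ≡ 46 * (p * q)
    regroup = ℕ-solve-∀

  exponent≤ : σ + (ν + ν + (ν + ν)) ≤ 198 * 12 ^ h
  exponent≤ = begin
    σ + (ν + ν + (ν + ν))                                     ≤⟨ ℕₚ.+-mono-≤ (ℕₚ.≤-trans σ≤ (ℕₚ.*-monoʳ-≤ 10 (ℕₚ.^-monoˡ-≤ h (ℕₚ.m≤m+n 4 8))))
                                                                   (ℕₚ.+-mono-≤ (ℕₚ.+-mono-≤ ν≤ ν≤) (ℕₚ.+-mono-≤ ν≤ ν≤)) ⟩
    10 * 12 ^ h + (47 * 12 ^ h + 47 * 12 ^ h + (47 * 12 ^ h + 47 * 12 ^ h)) ≡⟨ regroup (12 ^ h) ⟩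
    198 * 12 ^ h                                              ∎
    where
    open ℕₚ.≤-Reasoning
    regroup : ∀ p → 10 * p + (47 * p + 47 * p + (47 * p + 47 * p)) ≡ 198 * p
    regroup = ℕ-solve-∀

  log-sessions≤ : ⌊log₂ card session-finite ⌋ ≤ 198 * 12 ^ h
  log-sessions≤ = ℕₚ.≤-trans (⌊log₂⌋-mono-≤ sessions≤)
    (subst (_≤ 198 * 12 ^ h) (sym (⌊log₂[2^n]⌋≡n (σ + (ν + ν + (ν + ν))))) exponent≤)

  delay≤ : delay h ≤ 6 * 2 ^ h
  delay≤ = subst (delay h ≤_) (delay-closed h) (ℕₚ.m≤m+n (delay h) 5)

theorem1p3 : Σ ℕ λ p → Σ ℕ λ q → Σ ℕ λ a → Σ ℕ λ b →
    1 ≤ p × 1 ≤ q × 1 ≤ a × 1 ≤ b ×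
    ((K : ℕ) → Σ Instance λ M → WellFormed M × K ≤ Instance.k M ×
    Σ ℕ λ TC → 1 ≤ TC × CodingAchieves M TC ×
    ((TR : ℕ) → RoutingAchieves M TR →
    (a ^ q) * (TC ^ q) * (⌊log₂ Instance.k M ⌋ ^ p) ≤ (b * TR) ^ q))
-- The exponent is 1/7, as 7 is the least `q` with `2 ^ q * 12 ≤ 3 ^ q`; 6 comes from the coding
-- delay and 198 from the logarithm of the number of sessions. Depth `suc K` is nonzero and yields
-- at least `K` sessions.
theorem1p3 = 1 , 7 , 1 , 6 * 198 , s≤s z≤n , s≤s z≤n , s≤s z≤n , s≤s z≤n , λ K →
  let open Family (suc K)
      open Counting (suc K) Y using (κ)
      open Network (suc K) κ I using (M; session-finite; wellFormed)
  in M , wellFormed , ℕₚ.≤-trans (ℕₚ.n≤1+n K) (ℕₚ.≤-trans h≤Y Y≤sessions) ,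
     delay (suc K) , delay≥1 (suc K) , Coding.coding-makespan (suc K) κ I ,
     λ TR achieves → gap-bound 6 6 198 12 (suc K) (delay (suc K)) ⌊log₂ card session-finite ⌋ TR
       (s≤s z≤n) (ℕₚ.≤ᵇ⇒≤ (2 ^ 7 * 12) (3 ^ 7) tt) delay≤ log-sessions≤
       (Routing.routing-makespan (suc K) κ I (few-middles λ ()) (ℕₚ.≤-trans 1≤Y Y≤sessions) TR achieves)
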